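{- Let $(\mathcal I,\|-\|)$ be a complete interpretation of a circuit signature $\Sigma$. Then there is an isomorphism $\mathbf{SCirc}_{\Sigma/\approx_{\mathcal I}}\cong\mathbf{Stream}_{\mathcal I}$ between the PROP of sequential circuits modulo denotational equivalence and the PROP of causal, finitely specified and $\bot$-preserving monotone stream functions.
   Context: Circuits. A circuit signature $\Sigma$ consists of a finite set $\mathbf V$ of values with a distinguished value $\bullet$, a set $\mathcal P$ of primitive symbols, and functions $\mathrm{dom},\mathrm{cod}\colon\mathcal P\to\mathbb N$. A PROP is a strict symmetric monoidal category with objects $\mathbb N$ and addition as tensor on objects. $\mathbf{CCirc}_\Sigma$ is the PROP freely generated by: $p\colon\mathrm{dom}(p)\to\mathrm{cod}(p)$ for $p\in\mathcal P$, a fork $1\to2$, a join $2\to1$, an introduction $\bullet\colon0\to1$, and an elimination $1\to0$; its morphisms are combinational circuits. $\mathbf{SCirc}_\Sigma$ is the symmetric traced PROP freely generated by these together with a value $v\colon0\to1$ for each $v\in\mathbf V\setminus\{\bullet\}$ and a delay $\delta\colon1\to1$ (the "value" $\bullet$ means the introduction generator). Composition $f;g$ is in diagrammatic order; $\mathrm{Tr}^x$ sends $x+m\to x+n$ to $m\to n$. Forks, joins, delays $\delta_n$ and values $\overline v\colon0\to n$ ($\overline v\in\mathbf V^n$) on $n$ wires are defined wirewise. For $\overline v\in\mathbf V^n$ put $\mathrm{reg}(\overline v)\coloneqq(\overline v\otimes\delta_n);\mathrm{join}_n\colon n\to n$ and $\mathrm{const}(\overline v)\coloneqq\mathrm{Tr}^n(\mathrm{reg}(\overline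 v);\mathrm{fork}_n)\colon0\to n$. Interpretation. An interpretation $\mathcal I$ of $\Sigma$ is a lattice order $\sqsubseteq$ on $\mathbf V$ with $\bullet$ least (also written $\bot$) and, for each $p\in\mathcal P$, a $\bot$-preserving monotone function $[\![p]\!]\colon\mathbf V^{\mathrm{dom}(p)}\to\mathbf V^{\mathrm{cod}(p)}$. $\mathbf{Func}_{\mathcal I}$ is the PROP of $\bot$-preserving monotone functions $\mathbf V^m\to\mathbf V^n$. Streams. A stream function $f\colon A^\omega\to B^\omega$ is causal if $f(\sigma)(i)$ depends only on $\sigma(0),\dots,\sigma(i)$; its derivatives are $f_a=\sigma\mapsto\mathrm{tl}(f(a::\sigma))$, iterated along words; $f$ is finitely specified if it has finitely many iterated derivatives. $\mathbf{Stream}_{\mathcal I}$ is the PROP with morphisms $m\to n$ the causal, finitely specified and $\bot$-preserving monotone stream functions $(\mathbf V^m)^\omega\to(\mathbf V^n)^\omega$ (pointwise order), with function composition and Cartesian product as tensor; it is traced, the trace of $f\colon(\mathbf V^{x+m})^\omega\to(\mathbf V^{x+n})^\omega$ being $\sigma\mapsto\pi_1(f(\mu_f(\sigma),\sigma))$, where $\mu_f(\sigma)$ is the least fixed point of $\tau\mapsto\pi_0(f(\tau,\sigma))$. Mealy machines. A morphism $m\to n$ of the traced PROP $\mathbf{Mealy}_{\mathcal I}$ is an initialised monotone Mealy machine $(S,f,s_0)$: $S$ is a finite poset, $s_0\in S$, and $f\colon S\times\mathbf V^m\to S\times\mathbf V^n$ is $\bot$-preserving monotone; $f_0,f_1$ denote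 its transition and output components. Composition is the cascade product (state set $S\times T$; the second machine reads the outputs of the first), tensor is the direct product (the machines run side by side), and identities and symmetries are the evident single-state machines. The trace of $(S,f,s_0)\colon x+m\to x+n$ is the machine $m\to n$ with states $S$, initial state $s_0$, which in state $s$ on input $\overline a$ runs $f$ on $s$ and the concatenation of $\mu_s(\overline a)$ with $\overline a$ and discards the first $x$ outputs, where $\mu_s(\overline a)$ is the least fixed point of the function sending $\overline r$ to the first $x$ outputs of $f$ in state $s$ on input $\overline r$ concatenated with $\overline a$. The traced PROP morphism $!_{\mathcal I}(-)\colon\mathbf{Mealy}_{\mathcal I}\to\mathbf{Stream}_{\mathcal I}$ sends $(S,f,s_0)$ to the stream function whose $i$-th output on $\sigma$ is $f_1(r_i,\sigma(i))$, where $r_0=s_0$ and $r_{i+1}=f_0(r_i,\sigma(i))$. Denotation. $[-]_{\mathcal I}\colon\mathbf{SCirc}_\Sigma\to\mathbf{Mealy}_{\mathcal I}$ is the traced PROP morphism sending each primitive $p$, fork, join and elimination to the single-state machine with output function $[\![p]\!]$, $v\mapsto(v,v)$, $(v,w)\mapsto v\sqcup w$, $v\mapsto()$ respectively; each value $v$ to the machine with states $s_v,s_\bot$, initial state $s_v$, which outputs $v$ in $s_v$ and $\bot$ in $s_\bot$ and always moves to $s_\bot$; and the delay to the machine with states $\{s_v\mid v\in\mathbf V\}$, initial state $s_\bot$, which in state $s_v$ on input $a$ outputs $v$ and moves to $s_a$. The denotation is $[\![-]\!]^{\mathsf S}_{\mathcal I}\coloneqq\,!_{\mathcal I}(-)\circ[-]_{\mathcal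 I}\colon\mathbf{SCirc}_\Sigma\to\mathbf{Stream}_{\mathcal I}$. Two circuits $f,g\colon m\to n$ are denotationally equivalent, $f\approx_{\mathcal I}g$, if $[\![f]\!]^{\mathsf S}_{\mathcal I}=[\![g]\!]^{\mathsf S}_{\mathcal I}$; $\mathbf{SCirc}_{\Sigma/\approx_{\mathcal I}}$ is the quotient of $\mathbf{SCirc}_\Sigma$ by $\approx_{\mathcal I}$. Completeness. A complete interpretation is an interpretation with a map $\|-\|$ sending each $f\colon\mathbf V^m\to\mathbf V^n$ in $\mathbf{Func}_{\mathcal I}$ to a circuit of the form $(\mathrm{const}(\overline v)\otimes\mathrm{id}_m);g$ with $g$ combinational, such that $[\![\|f\|]\!]^{\mathsf S}_{\mathcal I}(\sigma)(i)=f(\sigma(i))$ for all $\sigma$ and $i$.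
   Formalization: The ⊥-preservation condition on stream functions is dropped in effect (recast so that every stream function meets it): read as f(⊥^ω)=⊥^ω it fails for the denotation v,⊥,⊥,… of a value v≠•, so the stated isomorphism would be false whenever V has two values. -}

module Defs where

open import Data.Bool.Base as Bool using (Bool; true; false; if_then_else_)
import Data.Bool.Properties as Bool
open import Data.Fin.Base as Fin using (Fin)
import Data.Fin.Properties as Fin
open import Data.List.Base as List using (List; []; _∷_)
open import Data.List.Relation.Unary.Any as Any using (Any; here; there)
import Data.List.Relation.Unary.Any.Properties as Any
open import Data.Nat.Base as ℕ using (ℕ; zero; suc; _+_)
open import Data.Nat.Properties
  using (+-assoc; +-identityʳ; ≤-refl; ≤-trans; n≤1+n; n<1+n; ≤⇒≤′)
open import Data.Product.Base using (_×_; _,_; proj₁; proj₂; ∃; Σ-syntax)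
open import Data.Product.Function.NonDependent.Propositional using (_×-↔_)
open import Data.Unit.Base using (⊤; tt)
open import Data.Vec.Base using (Vec; []; _∷_; _++_; take; drop; replicate; cast)
open import Data.Vec.Properties
  using (cast-is-id; ++-assoc-eqFree; ++-identityʳ-eqFree; take++drop≡id)
open import Data.Vec.Relation.Binary.Pointwise.Inductive as Pw using (Pointwise; []; _∷_)
open import Function.Base using (_∘_; id)
open import Function.Bundles using (_↔_; Inverse; Injection; mk↔ₛ′)
open import Function.Properties.Inverse using (↔⇒↣; ↔-sym; ↔-trans)
open import Level using (0ℓ)
open import Relation.Binary.Core using (Rel)
open import Relation.Binary.Definitions using (Minimum; DecidableEquality)
open import Relation.Binary.Lattice.Structures using (IsLattice)
open import Relation.Binary.PropositionalEquality
  using (_≡_; _≢_; refl; sym; trans; cong; cong₂; subst₂)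
  renaming (isEquivalence to ≡-isEquivalence)
open import Relation.Binary.Structures using (IsEquivalence; IsPartialOrder)
open import Relation.Nullary using (yes; no)

Finite : Set → Set
Finite A = ∃ λ k → A ↔ Fin k

-- Homs are setoids.  (m + n) + p and m + (n + p) are only propositionally equal
-- in ℕ, so the strictness laws for ⊗ on morphisms are stated after transport
-- along +-assoc and +-identityʳ.

record PROP : Set₁ where
  infix  4 _≈_
  infixl 6 _⨾_
  infixr 7 _⊗_
  field
    Hom           : ℕ → ℕ → Set
    _≈_           : ∀ {m n} → Rel (Hom m n) 0ℓ
    isEquivalence : ∀ {m n} → IsEquivalence (_≈_ {m} {n})
    idₘ           : ∀ n → Hom n n
    _⨾_           : ∀ {m n p} → Hom m n → Hom n p → Hom m p
    _⊗_           : ∀ {m n p q} → Hom m n → Hom p q → Hom (m + p) (n + q)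
    swap          : ∀ m n → Hom (m + n) (n + m)

  recast : ∀ {m m′ n n′} → m ≡ m′ → n ≡ n′ → Hom m n → Hom m′ n′
  recast = subst₂ Hom

  field
    ⨾-cong : ∀ {m n p} {f f′ : Hom m n} {g g′ : Hom n p} →
             f ≈ f′ → g ≈ g′ → f ⨾ g ≈ f′ ⨾ g′
    ⊗-cong : ∀ {m n p q} {f f′ : Hom m n} {g g′ : Hom p q} →
             f ≈ f′ → g ≈ g′ → f ⊗ g ≈ f′ ⊗ g′
    ⨾-idˡ   : ∀ {m n} (f : Hom m n) → idₘ m ⨾ f ≈ f
    ⨾-idʳ   : ∀ {m n} (f : Hom m n) → f ⨾ idₘ n ≈ f
    ⨾-assoc : ∀ {m n p q} (f : Hom m n) (g : Hom n p) (h : Hom p q) →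
              (f ⨾ g) ⨾ h ≈ f ⨾ (g ⨾ h)
    ⊗-id    : ∀ m n → idₘ m ⊗ idₘ n ≈ idₘ (m + n)
    ⊗-⨾     : ∀ {m n p m′ n′ p′}
              (f : Hom m n) (g : Hom n p) (f′ : Hom m′ n′) (g′ : Hom n′ p′) →
              (f ⨾ g) ⊗ (f′ ⨾ g′) ≈ (f ⊗ f′) ⨾ (g ⊗ g′)
    ⊗-unitˡ : ∀ {m n} (f : Hom m n) → idₘ 0 ⊗ f ≈ f
    ⊗-unitʳ : ∀ {m n} (f : Hom m n) →
              recast (+-identityʳ m) (+-identityʳ n) (f ⊗ idₘ 0) ≈ f
    ⊗-assoc : ∀ {m n p q r s} (f : Hom m n) (g : Hom p q) (h : Hom r s) →
              recast (+-assoc m p r) (+-assoc n q s) ((f ⊗ g) ⊗ h) ≈ f ⊗ (g ⊗ h)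
    swap-natural    : ∀ {m n p q} (f : Hom m n) (g : Hom p q) →
                      (f ⊗ g) ⨾ swap n q ≈ swap m p ⨾ (g ⊗ f)
    swap-involutive : ∀ m n → swap m n ⨾ swap n m ≈ idₘ (m + n)
    swap-hexagon    : ∀ m n p →
      swap m (n + p) ≈
      recast (+-assoc m n p) (+-assoc n m p) (swap m n ⊗ idₘ p) ⨾
      recast refl (sym (+-assoc n p m)) (idₘ n ⊗ swap m p)

record PROPMorphism (P Q : PROP) : Set where
  private
    module P = PROP P
    module Q = PROP Q
  field
    map      : ∀ {m n} → P.Hom m n → Q.Hom m n
    map-cong : ∀ {m n} {f g : P.Hom m n} → f P.≈ g → map f Q.≈ map g
    map-id   : ∀ n → map (P.idₘ n) Q.≈ Q.idₘ n
    map-⨾    : ∀ {m n p} (f : P.Hom m n) (g : P.Hom n p) → map (f P.⨾ g) Q.≈ map f Q.⨾ map g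
    map-⊗    : ∀ {m n p q} (f : P.Hom m n) (g : P.Hom p q) → map (f P.⊗ g) Q.≈ map f Q.⊗ map g
    map-swap : ∀ m n → map (P.swap m n) Q.≈ Q.swap m n

infix 4 _≅ᴾ_

record _≅ᴾ_ (P Q : PROP) : Set where
  private
    module P = PROP P
    module Q = PROP Q
  field
    to      : PROPMorphism P Q
    from    : PROPMorphism Q P
    from∘to : ∀ {m n} (f : P.Hom m n) → PROPMorphism.map from (PROPMorphism.map to f) P.≈ f
    to∘from : ∀ {m n} (g : Q.Hom m n) → PROPMorphism.map to (PROPMorphism.map from g) Q.≈ g

record Congruence (P : PROP) : Set₁ where
  open PROP P
  infix 4 _∼_
  field
    _∼_           : ∀ {m n} → Rel (Hom m n) 0ℓ
    ∼-equivalence : ∀ {m n} → IsEquivalence (_∼_ {m} {n})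
    ≈⇒∼           : ∀ {m n} {f g : Hom m n} → f ≈ g → f ∼ g
    ∼-⨾           : ∀ {m n p} {f f′ : Hom m n} {g g′ : Hom n p} →
                    f ∼ f′ → g ∼ g′ → f ⨾ g ∼ f′ ⨾ g′
    ∼-⊗           : ∀ {m n p q} {f f′ : Hom m n} {g g′ : Hom p q} →
                    f ∼ f′ → g ∼ g′ → f ⊗ g ∼ f′ ⊗ g′

_/_ : (P : PROP) → Congruence P → PROP
P / C = record
  { Hom = Hom ; _≈_ = _∼_ ; isEquivalence = ∼-equivalence
  ; idₘ = idₘ ; _⨾_ = _⨾_ ; _⊗_ = _⊗_ ; swap = swap
  ; ⨾-cong  = ∼-⨾
  ; ⊗-cong  = ∼-⊗
  ; ⨾-idˡ   = λ f → ≈⇒∼ (⨾-idˡ f)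
  ; ⨾-idʳ   = λ f → ≈⇒∼ (⨾-idʳ f)
  ; ⨾-assoc = λ f g h → ≈⇒∼ (⨾-assoc f g h)
  ; ⊗-id    = λ m n → ≈⇒∼ (⊗-id m n)
  ; ⊗-⨾     = λ f g f′ g′ → ≈⇒∼ (⊗-⨾ f g f′ g′)
  ; ⊗-unitˡ = λ f → ≈⇒∼ (⊗-unitˡ f)
  ; ⊗-unitʳ = λ f → ≈⇒∼ (⊗-unitʳ f)
  ; ⊗-assoc = λ f g h → ≈⇒∼ (⊗-assoc f g h)
  ; swap-natural    = λ f g → ≈⇒∼ (swap-natural f g)
  ; swap-involutive = λ m n → ≈⇒∼ (swap-involutive m n)
  ; swap-hexagon    = λ m n p → ≈⇒∼ (swap-hexagon m n p)
  }
  where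
  open PROP P
  open Congruence C

record Signature : Set₁ where
  field
    V        : Set
    V-finite : Finite V
    ●        : V
    Prim     : Set
    dom cod  : Prim → ℕ

  _≟_ : DecidableEquality V
  _≟_ = Fin.inj⇒≟ (↔⇒↣ (proj₂ V-finite))

module Circuits (Sg : Signature) where
  open Signature Sg

  data CGen : ℕ → ℕ → Set where
    prim  : (p : Prim) → CGen (dom p) (cod p)
    fork  : CGen 1 2
    join  : CGen 2 1
    intro : CGen 0 1
    elim  : CGen 1 0

  data SGen : ℕ → ℕ → Set where
    comb  : ∀ {m n} → CGen m n → SGen m n
    value : (v : V) → .(v ≢ ●) → SGen 0 1
    delay : SGen 1 1

  infixl 6 _⨾_
  infixr 7 _⊗_

  -- Only used through the embedding ⌊_⌋ into sequential circuits, so no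
  -- equational theory is imposed on these terms.
  data CCirc : ℕ → ℕ → Set where
    gen  : ∀ {m n} → CGen m n → CCirc m n
    idₘ  : ∀ n → CCirc n n
    _⨾_  : ∀ {m n p} → CCirc m n → CCirc n p → CCirc m p
    _⊗_  : ∀ {m n p q} → CCirc m n → CCirc p q → CCirc (m + p) (n + q)
    swap : ∀ m n → CCirc (m + n) (n + m)

  data SCircTerm : ℕ → ℕ → Set where
    gen  : ∀ {m n} → SGen m n → SCircTerm m n
    idₘ  : ∀ n → SCircTerm n n
    _⨾_  : ∀ {m n p} → SCircTerm m n → SCircTerm n p → SCircTerm m p
    _⊗_  : ∀ {m n p q} → SCircTerm m n → SCircTerm p q → SCircTerm (m + p) (n + q)
    swap : ∀ m n → SCircTerm (m + n) (n + m)
    Tr   : ∀ x {m n} → SCircTerm (x + m) (x + n) → SCircTerm m n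

  ⌊_⌋ : ∀ {m n} → CCirc m n → SCircTerm m n
  ⌊ gen g ⌋    = gen (comb g)
  ⌊ idₘ n ⌋    = idₘ n
  ⌊ f ⨾ g ⌋    = ⌊ f ⌋ ⨾ ⌊ g ⌋
  ⌊ f ⊗ g ⌋    = ⌊ f ⌋ ⊗ ⌊ g ⌋
  ⌊ swap m n ⌋ = swap m n

  recast : ∀ {m m′ n n′} → m ≡ m′ → n ≡ n′ → SCircTerm m n → SCircTerm m′ n′
  recast = subst₂ SCircTerm

  infix 4 _≃_
  data _≃_ : ∀ {m n} → SCircTerm m n → SCircTerm m n → Set where
    ≃-refl  : ∀ {m n} {f : SCircTerm m n} → f ≃ f
    ≃-sym   : ∀ {m n} {f g : SCircTerm m n} → f ≃ g → g ≃ f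
    ≃-trans : ∀ {m n} {f g h : SCircTerm m n} → f ≃ g → g ≃ h → f ≃ h
    ⨾-cong  : ∀ {m n p} {f f′ : SCircTerm m n} {g g′ : SCircTerm n p} →
              f ≃ f′ → g ≃ g′ → f ⨾ g ≃ f′ ⨾ g′
    ⊗-cong  : ∀ {m n p q} {f f′ : SCircTerm m n} {g g′ : SCircTerm p q} →
              f ≃ f′ → g ≃ g′ → f ⊗ g ≃ f′ ⊗ g′
    Tr-cong : ∀ x {m n} {f f′ : SCircTerm (x + m) (x + n)} → f ≃ f′ → Tr x f ≃ Tr x f′

    ⨾-idˡ   : ∀ {m n} (f : SCircTerm m n) → idₘ m ⨾ f ≃ f
    ⨾-idʳ   : ∀ {m n} (f : SCircTerm m n) → f ⨾ idₘ n ≃ f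
    ⨾-assoc : ∀ {m n p q} (f : SCircTerm m n) (g : SCircTerm n p) (h : SCircTerm p q) →
              (f ⨾ g) ⨾ h ≃ f ⨾ (g ⨾ h)
    ⊗-id    : ∀ m n → idₘ m ⊗ idₘ n ≃ idₘ (m + n)
    ⊗-⨾     : ∀ {m n p m′ n′ p′}
              (f : SCircTerm m n) (g : SCircTerm n p)
              (f′ : SCircTerm m′ n′) (g′ : SCircTerm n′ p′) →
              (f ⨾ g) ⊗ (f′ ⨾ g′) ≃ (f ⊗ f′) ⨾ (g ⊗ g′)
    ⊗-unitˡ : ∀ {m n} (f : SCircTerm m n) → idₘ 0 ⊗ f ≃ f
    ⊗-unitʳ : ∀ {m n} (f : SCircTerm m n) →
              recast (+-identityʳ m) (+-identityʳ n) (f ⊗ idₘ 0) ≃ f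
    ⊗-assoc : ∀ {m n p q r s}
              (f : SCircTerm m n) (g : SCircTerm p q) (h : SCircTerm r s) →
              recast (+-assoc m p r) (+-assoc n q s) ((f ⊗ g) ⊗ h) ≃ f ⊗ (g ⊗ h)
    swap-natural    : ∀ {m n p q} (f : SCircTerm m n) (g : SCircTerm p q) →
                      (f ⊗ g) ⨾ swap n q ≃ swap m p ⨾ (g ⊗ f)
    swap-involutive : ∀ m n → swap m n ⨾ swap n m ≃ idₘ (m + n)
    swap-hexagon    : ∀ m n p →
      swap m (n + p) ≃
      recast (+-assoc m n p) (+-assoc n m p) (swap m n ⊗ idₘ p) ⨾
      recast refl (sym (+-assoc n p m)) (idₘ n ⊗ swap m p)

    tightening  : ∀ x {m m′ n n′} (g : SCircTerm m m′)
                  (f : SCircTerm (x + m′) (x + n′)) (h : SCircTerm n′ n) →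
                  Tr x ((idₘ x ⊗ g) ⨾ f ⨾ (idₘ x ⊗ h)) ≃ g ⨾ Tr x f ⨾ h
    sliding     : ∀ x y {m n} (f : SCircTerm (x + m) (y + n)) (g : SCircTerm y x) →
                  Tr x (f ⨾ (g ⊗ idₘ n)) ≃ Tr y ((g ⊗ idₘ m) ⨾ f)
    vanishing₀  : ∀ {m n} (f : SCircTerm m n) → Tr 0 f ≃ f
    vanishing₊  : ∀ x y {m n} (f : SCircTerm (x + (y + m)) (x + (y + n))) →
                  Tr (x + y) (recast (sym (+-assoc x y m)) (sym (+-assoc x y n)) f) ≃
                  Tr y (Tr x f)
    superposing : ∀ x {m n} (f : SCircTerm (x + m) (x + n)) p →
                  Tr x (recast (+-assoc x m p) (+-assoc x n p) (f ⊗ idₘ p)) ≃ Tr x f ⊗ idₘ p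
    yanking     : ∀ x → Tr x (swap x x) ≃ idₘ x

  SCirc : PROP
  SCirc = record
    { Hom = SCircTerm ; _≈_ = _≃_
    ; isEquivalence = record { refl = ≃-refl ; sym = ≃-sym ; trans = ≃-trans }
    ; idₘ = idₘ ; _⨾_ = _⨾_ ; _⊗_ = _⊗_ ; swap = swap
    ; ⨾-cong = ⨾-cong ; ⊗-cong = ⊗-cong
    ; ⨾-idˡ = ⨾-idˡ ; ⨾-idʳ = ⨾-idʳ ; ⨾-assoc = ⨾-assoc
    ; ⊗-id = ⊗-id ; ⊗-⨾ = ⊗-⨾ ; ⊗-unitˡ = ⊗-unitˡ ; ⊗-unitʳ = ⊗-unitʳ ; ⊗-assoc = ⊗-assoc
    ; swap-natural = swap-natural ; swap-involutive = swap-involutive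
    ; swap-hexagon = swap-hexagon
    }

  val₁ : V → SCircTerm 0 1
  val₁ v with v ≟ ●
  ... | yes _   = gen (comb intro)
  ... | no  v≢● = gen (value v v≢●)

  values : ∀ {n} → Vec V n → SCircTerm 0 n
  values []       = idₘ 0
  values (v ∷ vs) = val₁ v ⊗ values vs

  delays : ∀ n → SCircTerm n n
  delays zero    = idₘ 0
  delays (suc n) = gen delay ⊗ delays n

  forks : ∀ n → SCircTerm n (n + n)
  forks zero    = idₘ 0
  forks (suc n) =
    (gen (comb fork) ⊗ forks n) ⨾
    (idₘ 1 ⊗ recast refl (+-assoc n 1 n) (swap 1 n ⊗ idₘ n))

  joins : ∀ n → SCircTerm (n + n) n
  joins zero    = idₘ 0
  joins (suc n) =
    (idₘ 1 ⊗ recast (+-assoc n 1 n) refl (swap n 1 ⊗ idₘ n)) ⨾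
    (gen (comb join) ⊗ joins n)

  reg : ∀ {n} → Vec V n → SCircTerm n n
  reg {n} v̄ = (values v̄ ⊗ delays n) ⨾ joins n

  const : ∀ {n} → Vec V n → SCircTerm 0 n
  const {n} v̄ = Tr n (recast (sym (+-identityʳ n)) refl (reg v̄ ⨾ forks n))

  record ConstForm (m n : ℕ) : Set where
    field
      {width} : ℕ
      consts  : Vec V width
      body    : CCirc (width + m) n

    circuit : SCircTerm m n
    circuit = (const consts ⊗ idₘ m) ⨾ ⌊ body ⌋

module Order {V : Set} (_⊑_ : V → V → Set) (● : V) where
  infix 4 _⊑ⱽ_

  _⊑ⱽ_ : ∀ {n} → Rel (Vec V n) 0ℓ
  _⊑ⱽ_ = Pointwise _⊑_

  ⊥ⱽ : ∀ {n} → Vec V n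
  ⊥ⱽ = replicate _ ●

  record Func (m n : ℕ) : Set where
    field
      fun          : Vec V m → Vec V n
      monotone     : ∀ {u v} → u ⊑ⱽ v → fun u ⊑ⱽ fun v
      ⊥-preserving : fun ⊥ⱽ ≡ ⊥ⱽ

record Interpretation (Sg : Signature) : Set₁ where
  open Signature Sg
  infix  4 _⊑_
  infixr 6 _⊔_
  infixr 7 _⊓_
  field
    _⊑_       : V → V → Set
    _⊔_ _⊓_   : V → V → V
    isLattice : IsLattice _≡_ _⊑_ _⊔_ _⊓_
    ●-least   : Minimum _⊑_ ●

  open Order _⊑_ ● public

  field
    ⟦_⟧ᵖ : (p : Prim) → Func (dom p) (cod p)

Stream : Set → Set
Stream A = ℕ → A

infixr 5 _∷ˢ_
_∷ˢ_ : ∀ {A} → A → Stream A → Stream A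
(a ∷ˢ σ) zero    = a
(a ∷ˢ σ) (suc i) = σ i

tl : ∀ {A} → Stream A → Stream A
tl σ i = σ (suc i)

module StreamFunctions {A B : Set} where

  infix 4 _≋_
  _≋_ : Rel (Stream A → Stream B) 0ℓ
  f ≋ g = ∀ σ i → f σ i ≡ g σ i

  Causal : (Stream A → Stream B) → Set
  Causal f = ∀ {σ τ} i → (∀ {j} → j ℕ.≤ i → σ j ≡ τ j) → f σ i ≡ f τ i

  derivative : (Stream A → Stream B) → A → Stream A → Stream B
  derivative f a σ = tl (f (a ∷ˢ σ))

  derivative* : (Stream A → Stream B) → List A → Stream A → Stream B
  derivative* f []      = f
  derivative* f (a ∷ w) = derivative* (derivative f a) w

  -- Finitely many iterated derivatives, up to pointwise equality.
  FinitelySpecified : (Stream A → Stream B) → Set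
  FinitelySpecified f = Σ[ L ∈ List (Stream A → Stream B) ] (∀ w → Any (derivative* f w ≋_) L)

open StreamFunctions

module _ {A : Set} where

  take-++ : ∀ {m n} (u : Vec A m) (v : Vec A n) → take m (u ++ v) ≡ u
  take-++ []      v = refl
  take-++ (x ∷ u) v = cong (x ∷_) (take-++ u v)

  drop-++ : ∀ {m n} (u : Vec A m) (v : Vec A n) → drop m (u ++ v) ≡ v
  drop-++ []      v = refl
  drop-++ (x ∷ u) v = drop-++ u v

  take-replicate : ∀ m n (a : A) → take m (replicate (m + n) a) ≡ replicate m a
  take-replicate zero    n a = refl
  take-replicate (suc m) n a = cong (a ∷_) (take-replicate m n a)

  drop-replicate : ∀ m n (a : A) → drop m (replicate (m + n) a) ≡ replicate n a
  drop-replicate zero    n a = refl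
  drop-replicate (suc m) n a = drop-replicate m n a

  replicate-++ : ∀ m n (a : A) → replicate m a ++ replicate n a ≡ replicate (m + n) a
  replicate-++ zero    n a = refl
  replicate-++ (suc m) n a = cong (a ∷_) (replicate-++ m n a)

  module _ (m n p : ℕ) where

    cast-assoc : Vec A ((m + n) + p) → Vec A (m + (n + p))
    cast-assoc = cast (+-assoc m n p)

    cast-assoc⁻ : Vec A (m + (n + p)) → Vec A ((m + n) + p)
    cast-assoc⁻ = cast (sym (+-assoc m n p))

  cast-cast : ∀ {m n} (p : m ≡ n) (v : Vec A m) → cast (sym p) (cast p v) ≡ v
  cast-cast refl v = trans (cast-is-id refl _) (cast-is-id refl v)

  cast-cast′ : ∀ {m n} (p : m ≡ n) (v : Vec A n) → cast p (cast (sym p) v) ≡ v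
  cast-cast′ refl v = trans (cast-is-id refl _) (cast-is-id refl v)

  cast-assoc⁻-++ : ∀ {m n p} (u : Vec A m) (v : Vec A n) (w : Vec A p) →
                   cast-assoc⁻ m n p (u ++ (v ++ w)) ≡ (u ++ v) ++ w
  cast-assoc⁻-++ {m} {n} {p} u v w =
    trans (cong (cast-assoc⁻ m n p) (sym (++-assoc-eqFree u v w))) (cast-cast (+-assoc m n p) _)

  take-take : ∀ m n p (v : Vec A (m + (n + p))) →
              take m (take (m + n) (cast-assoc⁻ m n p v)) ≡ take m v
  drop-take : ∀ m n p (v : Vec A (m + (n + p))) →
              drop m (take (m + n) (cast-assoc⁻ m n p v)) ≡ take n (drop m v)
  drop-drop : ∀ m n p (v : Vec A (m + (n + p))) →
              drop (m + n) (cast-assoc⁻ m n p v) ≡ drop n (drop m v)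
  take-take zero    n p v       = refl
  take-take (suc m) n p (x ∷ v) = cong (x ∷_) (take-take m n p v)
  drop-take zero    n p v       = cong (take n) (cast-is-id refl v)
  drop-take (suc m) n p (x ∷ v) = drop-take m n p v
  drop-drop zero    n p v       = cong (drop n) (cast-is-id refl v)
  drop-drop (suc m) n p (x ∷ v) = drop-drop m n p v

  swapⱽ : ∀ m n → Vec A (m + n) → Vec A (n + m)
  swapⱽ m n v = drop m v ++ take m v

module Semantics (Sg : Signature) (I : Interpretation Sg) where
  open Signature Sg
  open Interpretation I
  open Circuits Sg
  private
    module L = IsLattice isLattice

  V^ : ℕ → Set
  V^ n = Vec V n

  ⊑ⱽ-refl : ∀ {n} {u : V^ n} → u ⊑ⱽ u
  ⊑ⱽ-refl = Pw.refl L.refl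

  ⊑ⱽ-reflexive : ∀ {n} {u v : V^ n} → u ≡ v → u ⊑ⱽ v
  ⊑ⱽ-reflexive refl = ⊑ⱽ-refl

  ⊑ⱽ-trans : ∀ {n} {u v w : V^ n} → u ⊑ⱽ v → v ⊑ⱽ w → u ⊑ⱽ w
  ⊑ⱽ-trans = Pw.trans L.trans

  ⊑ⱽ-antisym : ∀ {n} {u v : V^ n} → u ⊑ⱽ v → v ⊑ⱽ u → u ≡ v
  ⊑ⱽ-antisym []       []       = refl
  ⊑ⱽ-antisym (p ∷ ps) (q ∷ qs) = cong₂ _∷_ (L.antisym p q) (⊑ⱽ-antisym ps qs)

  ⊥ⱽ-least : ∀ {n} (v : V^ n) → ⊥ⱽ ⊑ⱽ v
  ⊥ⱽ-least []      = []
  ⊥ⱽ-least (x ∷ v) = ●-least x ∷ ⊥ⱽ-least v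

  take-mono : ∀ m {n} {u v : V^ (m + n)} → u ⊑ⱽ v → take m u ⊑ⱽ take m v
  take-mono zero    p                                = []
  take-mono (suc m) {u = _ ∷ _} {v = _ ∷ _} (p ∷ ps) = p ∷ take-mono m ps

  drop-mono : ∀ m {n} {u v : V^ (m + n)} → u ⊑ⱽ v → drop m u ⊑ⱽ drop m v
  drop-mono zero    p                                = p
  drop-mono (suc m) {u = _ ∷ _} {v = _ ∷ _} (p ∷ ps) = drop-mono m ps

  cast-mono : ∀ {m n} (eq : m ≡ n) {u v : V^ m} → u ⊑ⱽ v → cast eq u ⊑ⱽ cast eq v
  cast-mono refl p =
    ⊑ⱽ-trans (⊑ⱽ-reflexive (cast-is-id refl _))
             (⊑ⱽ-trans p (⊑ⱽ-reflexive (sym (cast-is-id refl _))))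

  cast-⊥ : ∀ {m n} (eq : m ≡ n) → cast eq ⊥ⱽ ≡ ⊥ⱽ
  cast-⊥ refl = cast-is-id refl _

  V^-finite : ∀ n → Finite (V^ n)
  V^-finite zero    = 1 , mk↔ₛ′ (λ _ → Fin.zero) (λ _ → []) (λ { Fin.zero → refl ; (Fin.suc ()) }) (λ { [] → refl })
  V^-finite (suc n) =
    proj₁ V-finite ℕ.* proj₁ (V^-finite n) ,
    ↔-trans (mk↔ₛ′ (λ { (x ∷ v) → x , v }) (λ { (x , v) → x ∷ v }) (λ { (x , v) → refl }) (λ { (x ∷ v) → refl }))
            (↔-trans (proj₂ V-finite ×-↔ proj₂ (V^-finite n)) (↔-sym Fin.*↔×))

  IsLeastFixedPoint : ∀ {n} → (V^ n → V^ n) → V^ n → Set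
  IsLeastFixedPoint g r = g r ≡ r × (∀ s → g s ≡ s → r ⊑ⱽ s)

  module LeastFixedPoint {n} (g : V^ n → V^ n) (g-mono : ∀ {u v} → u ⊑ⱽ v → g u ⊑ⱽ g v) where

    iterate : ℕ → V^ n
    iterate zero    = ⊥ⱽ
    iterate (suc k) = g (iterate k)

    iterate-step : ∀ k → iterate k ⊑ⱽ iterate (suc k)
    iterate-step zero    = ⊥ⱽ-least _
    iterate-step (suc k) = g-mono (iterate-step k)

    iterate-mono′ : ∀ {j k} → j ℕ.≤′ k → iterate j ⊑ⱽ iterate k
    iterate-mono′ (ℕ.≤′-reflexive refl) = ⊑ⱽ-refl
    iterate-mono′ (ℕ.≤′-step {k} p)     = ⊑ⱽ-trans (iterate-mono′ p) (iterate-step k)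

    iterate-least : ∀ k {s} → g s ⊑ⱽ s → iterate k ⊑ⱽ s
    iterate-least zero    p = ⊥ⱽ-least _
    iterate-least (suc k) p = ⊑ⱽ-trans (g-mono (iterate-least k p)) p

    stable : ∃ λ k → g (iterate k) ≡ iterate k
    stable with Fin.pigeonhole (n<1+n _) (Inverse.to (proj₂ (V^-finite n)) ∘ iterate ∘ Fin.toℕ)
    ... | i , j , i<j , eq =
      Fin.toℕ i ,
      ⊑ⱽ-antisym
        (⊑ⱽ-trans (iterate-mono′ (≤⇒≤′ i<j))
                  (⊑ⱽ-reflexive (sym (Injection.injective (↔⇒↣ (proj₂ (V^-finite n))) eq))))
        (iterate-step (Fin.toℕ i))

    lfp : V^ n
    lfp = iterate (proj₁ stable)

    lfp-fixed : g lfp ≡ lfp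
    lfp-fixed = proj₂ stable

    lfp-least-prefixed : ∀ {s} → g s ⊑ⱽ s → lfp ⊑ⱽ s
    lfp-least-prefixed = iterate-least (proj₁ stable)

    lfp-isLeastFixedPoint : IsLeastFixedPoint g lfp
    lfp-isLeastFixedPoint = lfp-fixed , λ s p → lfp-least-prefixed (⊑ⱽ-reflexive p)

  StreamFun : ℕ → ℕ → Set
  StreamFun m n = Stream (V^ m) → Stream (V^ n)

  infix 4 _⊑ˢ_ _⊑ᶠ_

  _⊑ˢ_ : ∀ {n} → Stream (V^ n) → Stream (V^ n) → Set
  σ ⊑ˢ τ = ∀ i → σ i ⊑ⱽ τ i

  _⊑ᶠ_ : ∀ {m n} → StreamFun m n → StreamFun m n → Set
  f ⊑ᶠ g = ∀ σ → f σ ⊑ˢ g σ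

  Monotone : ∀ {m n} → StreamFun m n → Set
  Monotone f = ∀ {σ τ} → σ ⊑ˢ τ → f σ ⊑ˢ f τ

  -- As for Mealy machines, ⊥-preservation constrains the structure map
  -- (g , a) ↦ (derivative of g by a , first output of g on a) on states, not
  -- the initial state: below all iterated derivatives of f there is a least
  -- state bot which the structure map sends, on input ⊥, to bot and output ⊥.
  -- It is not the equation f(⊥⊥⊥…) = ⊥⊥⊥…, which the denotation of a value
  -- v ≢ ● violates.  In this sense every stream function is ⊥-preserving
  -- (⊥-preserving-always), so the condition excludes nothing.
  record ⊥-Preserving {m n} (f : StreamFun m n) : Set where
    field
      bot          : StreamFun m n
      bot-causal   : Causal bot
      bot-monotone : Monotone bot
      bot-below    : ∀ w → bot ⊑ᶠ derivative* f w
      bot-step     : ∀ σ i → bot (⊥ⱽ ∷ˢ σ) i ≡ (⊥ⱽ ∷ˢ bot σ) i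

  ⊥-preserving-always : ∀ {m n} (f : StreamFun m n) → ⊥-Preserving f
  ⊥-preserving-always f = record
    { bot          = λ _ _ → ⊥ⱽ
    ; bot-causal   = λ _ _ → refl
    ; bot-monotone = λ _ _ → ⊑ⱽ-refl
    ; bot-below    = λ _ _ _ → ⊥ⱽ-least _
    ; bot-step     = λ { σ zero → refl ; σ (suc i) → refl }
    }

  record StreamMor (m n : ℕ) : Set where
    no-eta-equality
    field
      fun               : StreamFun m n
      causal            : Causal fun
      finitelySpecified : FinitelySpecified fun
      monotone          : Monotone fun
      ⊥-preserving      : ⊥-Preserving fun

    ext : ∀ {σ τ} → (∀ i → σ i ≡ τ i) → ∀ i → fun σ i ≡ fun τ i
    ext p i = causal i (λ {j} _ → p j)

  open StreamMor

  infix 4 _≈ˢ_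
  _≈ˢ_ : ∀ {m n} → StreamMor m n → StreamMor m n → Set
  f ≈ˢ g = fun f ≋ fun g

  tensorFun : ∀ {m n p q} → StreamFun m n → StreamFun p q → StreamFun (m + p) (n + q)
  tensorFun {m} f g σ i = f (take m ∘ σ) i ++ g (drop m ∘ σ) i

  mapFun : ∀ {m n} → (V^ m → V^ n) → StreamFun m n
  mapFun h σ i = h (σ i)

  derivative*-cong : ∀ {m n} {f g : StreamFun m n} → f ≋ g →
                     ∀ w → derivative* f w ≋ derivative* g w
  derivative*-cong p []      = p
  derivative*-cong p (a ∷ w) = derivative*-cong (λ σ i → p (a ∷ˢ σ) (suc i)) w

  derivative-causal : ∀ {m n} {f : StreamFun m n} → Causal f → ∀ a → Causal (derivative f a)
  derivative-causal c a i p = c (suc i) λ { {zero} _ → refl ; {suc j} (ℕ.s≤s j≤i) → p j≤i }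

  derivative*-causal : ∀ {m n} {f : StreamFun m n} → Causal f → ∀ w → Causal (derivative* f w)
  derivative*-causal c []      = c
  derivative*-causal c (a ∷ w) = derivative*-causal (derivative-causal c a) w

  mapFun-derivative* : ∀ {m n} (h : V^ m → V^ n) w → derivative* (mapFun h) w ≋ mapFun h
  mapFun-derivative* h []      σ i = refl
  mapFun-derivative* h (a ∷ w) σ i = mapFun-derivative* h w σ i

  mapMor : ∀ {m n} → (h : V^ m → V^ n) → (∀ {u v} → u ⊑ⱽ v → h u ⊑ⱽ h v) → StreamMor m n
  mapMor h h-mono .fun = mapFun h
  mapMor h h-mono .causal i p = cong h (p ≤-refl)
  mapMor h h-mono .finitelySpecified = (mapFun h ∷ []) , λ w → here (mapFun-derivative* h w)
  mapMor h h-mono .monotone p i = h-mono (p i)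
  mapMor h h-mono .⊥-preserving = ⊥-preserving-always _

  outputs : ∀ {m n} → StreamFun m n → List (V^ m) → List (V^ n)
  outputs f []      = []
  outputs f (a ∷ w) = f (λ _ → a) 0 ∷ outputs (derivative f a) w

  compose-derivative* :
    ∀ {m n p} {f : StreamFun m n} {g : StreamFun n p} → Causal f → Causal g → ∀ w →
    derivative* (g ∘ f) w ≋ derivative* g (outputs f w) ∘ derivative* f w
  compose-derivative* cf cg [] σ i = refl
  compose-derivative* {f = f} {g} cf cg (a ∷ w) σ i =
    trans (derivative*-cong step w σ i)
          (compose-derivative* (derivative-causal cf a) (derivative-causal cg _) w σ i)
    where
    step : derivative (g ∘ f) a ≋ derivative g (f (λ _ → a) 0) ∘ derivative f a
    step σ i = cg (suc i) λ { {zero} _  → cf 0 (λ { {zero} _ → refl ; {suc _} () })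
                            ; {suc j} _ → refl }

  composeMor : ∀ {m n p} → StreamMor m n → StreamMor n p → StreamMor m p
  composeMor f g .fun = fun g ∘ fun f
  composeMor f g .causal i p = causal g i (λ j≤i → causal f _ (λ k≤j → p (≤-trans k≤j j≤i)))
  composeMor f g .finitelySpecified =
    List.cartesianProductWith (λ f′ g′ → g′ ∘ f′)
      (proj₁ (finitelySpecified f)) (proj₁ (finitelySpecified g)) , λ w →
    Any.cartesianProductWith⁺ (λ f′ g′ → g′ ∘ f′)
      (λ {f′} p q σ i →
        trans (compose-derivative* (causal f) (causal g) w σ i)
        (trans (derivative*-causal (causal g) (outputs (fun f) w) i (λ {j} _ → p σ j))
               (q (f′ σ) i)))
      (proj₂ (finitelySpecified f) w)
      (proj₂ (finitelySpecified g) (outputs (fun f) w))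
  composeMor f g .monotone p = monotone g (monotone f p)
  composeMor f g .⊥-preserving = ⊥-preserving-always _

  tensor-derivative* :
    ∀ {m n p q} {f : StreamFun m n} {g : StreamFun p q} → Causal f → Causal g → ∀ w →
    derivative* (tensorFun f g) w ≋
    tensorFun (derivative* f (List.map (take m) w)) (derivative* g (List.map (drop m) w))
  tensor-derivative* cf cg [] σ i = refl
  tensor-derivative* {m} {f = f} {g} cf cg (a ∷ w) σ i =
    trans (derivative*-cong step w σ i)
          (tensor-derivative* (derivative-causal cf _) (derivative-causal cg _) w σ i)
    where
    step : derivative (tensorFun f g) a ≋
           tensorFun (derivative f (take m a)) (derivative g (drop m a))
    step σ i = cong₂ _++_ (cf (suc i) λ { {zero} _ → refl ; {suc _} _ → refl })
                          (cg (suc i) λ { {zero} _ → refl ; {suc _} _ → refl })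

  tensorMor : ∀ {m n p q} → StreamMor m n → StreamMor p q → StreamMor (m + p) (n + q)
  tensorMor f g .fun = tensorFun (fun f) (fun g)
  tensorMor {m} f g .causal i p = cong₂ _++_ (causal f i (λ j≤i → cong (take m) (p j≤i)))
                                             (causal g i (λ j≤i → cong (drop m) (p j≤i)))
  tensorMor {m} f g .finitelySpecified =
    List.cartesianProductWith tensorFun
      (proj₁ (finitelySpecified f)) (proj₁ (finitelySpecified g)) , λ w →
    Any.cartesianProductWith⁺ tensorFun
      (λ p q σ i → trans (tensor-derivative* (causal f) (causal g) w σ i)
                         (cong₂ _++_ (p _ i) (q _ i)))
      (proj₂ (finitelySpecified f) (List.map (take m) w))
      (proj₂ (finitelySpecified g) (List.map (drop m) w))
  tensorMor {m} f g .monotone p i = Pw.++⁺ (monotone f (λ j → take-mono m (p j)) i)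
                                           (monotone g (λ j → drop-mono m (p j)) i)
  tensorMor f g .⊥-preserving = ⊥-preserving-always _

  idMor : ∀ n → StreamMor n n
  idMor n = mapMor id id

  swap-mono : ∀ m n {u v : V^ (m + n)} → u ⊑ⱽ v → swapⱽ m n u ⊑ⱽ swapⱽ m n v
  swap-mono m n p = Pw.++⁺ (drop-mono m p) (take-mono m p)

  swapMor : ∀ m n → StreamMor (m + n) (n + m)
  swapMor m n = mapMor (swapⱽ m n) (swap-mono m n)

  fun-recast : ∀ {m m′ n n′} (p : m ≡ m′) (q : n ≡ n′) (f : StreamMor m n) →
               fun (subst₂ StreamMor p q f) ≋ λ σ i → cast q (fun f (cast (sym p) ∘ σ) i)
  fun-recast refl refl f σ i =
    sym (trans (cast-is-id refl _) (ext f (λ j → cast-is-id refl (σ j)) i))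

  swapⱽ-++ : ∀ {m n} (u : V^ m) (v : V^ n) → swapⱽ m n (u ++ v) ≡ v ++ u
  swapⱽ-++ u v = cong₂ _++_ (drop-++ u v) (take-++ u v)

  StreamPROP : PROP
  StreamPROP = record
    { Hom = StreamMor ; _≈_ = _≈ˢ_
    ; isEquivalence = record
        { refl  = λ σ i → refl
        ; sym   = λ p σ i → sym (p σ i)
        ; trans = λ p q σ i → trans (p σ i) (q σ i) }
    ; idₘ = idMor ; _⨾_ = composeMor ; _⊗_ = tensorMor ; swap = swapMor
    ; ⨾-cong = λ {_} {_} {_} {f} {f′} {g} {g′} p q σ i →
        trans (ext g (p σ) i) (q (fun f′ σ) i)
    ; ⊗-cong = λ p q σ i → cong₂ _++_ (p _ i) (q _ i)
    ; ⨾-idˡ = λ f σ i → refl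
    ; ⨾-idʳ = λ f σ i → refl
    ; ⨾-assoc = λ f g h σ i → refl
    ; ⊗-id = λ m n σ i → take++drop≡id m (σ i)
    ; ⊗-⨾ = λ {_} {n} f g f′ g′ σ i → cong₂ _++_
        (ext g (λ j → sym (take-++ (fun f _ j) (fun f′ _ j))) i)
        (ext g′ (λ j → sym (drop-++ (fun f _ j) (fun f′ _ j))) i)
    ; ⊗-unitˡ = λ f σ i → refl
    ; ⊗-unitʳ = λ {m} {n} f σ i →
        trans (fun-recast (+-identityʳ m) (+-identityʳ n) (tensorMor f (idMor 0)) σ i)
        (trans (cong (cast (+-identityʳ n)) (cong (fun f _ i ++_) (0-unique _)))
        (trans (++-identityʳ-eqFree _)
               (ext f (λ j → take-cast-0 m (σ j)) i)))
    ; ⊗-assoc = λ {m} {n} {p} {q} {r} {s} f g h σ i →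
        trans (fun-recast (+-assoc m p r) (+-assoc n q s) (tensorMor (tensorMor f g) h) σ i)
        (trans (++-assoc-eqFree (fun f _ i) (fun g _ i) (fun h _ i))
        (cong₂ _++_ (ext f (λ j → take-take m p r (σ j)) i)
          (cong₂ _++_ (ext g (λ j → drop-take m p r (σ j)) i)
                      (ext h (λ j → drop-drop m p r (σ j)) i))))
    ; swap-natural = λ {m} {n} {p} {q} f g σ i →
        trans (swapⱽ-++ (fun f _ i) (fun g _ i))
        (sym (cong₂ _++_ (ext g (λ j → take-++ (drop m (σ j)) (take m (σ j))) i)
                         (ext f (λ j → drop-++ (drop m (σ j)) (take m (σ j))) i)))
    ; swap-involutive = λ m n σ i →
        trans (swapⱽ-++ (drop m (σ i)) (take m (σ i))) (take++drop≡id m (σ i))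
    ; swap-hexagon = λ m n p σ i → sym (hexagon m n p σ i)
    }
    where
    0-unique : (v : V^ 0) → v ≡ []
    0-unique [] = refl

    take-cast-0 : ∀ m (v : V^ m) → take m (cast (sym (+-identityʳ m)) v) ≡ v
    take-cast-0 zero    []      = refl
    take-cast-0 (suc m) (x ∷ v) = cong (x ∷_) (take-cast-0 m v)

    first : ∀ m n p → StreamMor (m + (n + p)) (n + (m + p))
    first m n p = subst₂ StreamMor (+-assoc m n p) (+-assoc n m p) (tensorMor (swapMor m n) (idMor p))

    first-fun : ∀ m n p σ i → fun (first m n p) σ i ≡
                take n (drop m (σ i)) ++ (take m (σ i) ++ drop n (drop m (σ i)))
    first-fun m n p σ i =
      trans (fun-recast (+-assoc m n p) (+-assoc n m p) (tensorMor (swapMor m n) (idMor p)) σ i)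
      (trans (++-assoc-eqFree (drop m (take (m + n) x)) (take m (take (m + n) x)) (drop (m + n) x))
      (cong₂ _++_ (drop-take m n p (σ i)) (cong₂ _++_ (take-take m n p (σ i)) (drop-drop m n p (σ i)))))
      where x = cast-assoc⁻ m n p (σ i)

    hexagon : ∀ m n p σ i →
      fun (subst₂ StreamMor refl (sym (+-assoc n p m)) (tensorMor (idMor n) (swapMor m p)))
          (fun (first m n p) σ) i ≡
      swapⱽ m (n + p) (σ i)
    hexagon m n p σ i =
      trans (fun-recast refl (sym (+-assoc n p m)) (tensorMor (idMor n) (swapMor m p)) _ i)
      (trans (cong (cast-assoc⁻ n p m)
        (trans (cong (λ z → take n z ++ swapⱽ m p (drop n z))
                 (trans (cast-is-id refl _) (first-fun m n p σ i)))
        (cong₂ _++_ (take-++ a (b ++ c))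
               (trans (cong (swapⱽ m p) (drop-++ a (b ++ c))) (swapⱽ-++ b c)))))
      (trans (cast-assoc⁻-++ a c b)
             (cong (_++ b) (take++drop≡id n (drop m (σ i))))))
      where
      a = take n (drop m (σ i))
      b = take m (σ i)
      c = drop n (drop m (σ i))

  -- A ⊥-preserving step presupposes that the poset of states has a least element.
  record Mealy (m n : ℕ) : Set₁ where
    no-eta-equality
    infix 4 _≤_
    field
      State          : Set
      _≤_            : State → State → Set
      isPartialOrder : IsPartialOrder _≡_ _≤_
      finite         : Finite State
      ⊥ˢ             : State
      ⊥ˢ-least       : Minimum _≤_ ⊥ˢ
      init           : State
      step           : State × V^ m → State × V^ n
      step-monotone  : ∀ {s t u v} → s ≤ t → u ⊑ⱽ v →
                       (proj₁ (step (s , u)) ≤ proj₁ (step (t , v))) ×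
                       (proj₂ (step (s , u)) ⊑ⱽ proj₂ (step (t , v)))
      step-⊥         : step (⊥ˢ , ⊥ⱽ) ≡ (⊥ˢ , ⊥ⱽ)

    next : State → V^ m → State
    next s u = proj₁ (step (s , u))

    out : State → V^ m → V^ n
    out s u = proj₂ (step (s , u))

    ≤-rfl : ∀ {s} → s ≤ s
    ≤-rfl = IsPartialOrder.refl isPartialOrder

    out-mono : ∀ {s t u v} → s ≤ t → u ⊑ⱽ v → out s u ⊑ⱽ out t v
    out-mono p q = proj₂ (step-monotone p q)

    run : State → Stream (V^ m) → Stream State
    run s σ zero    = s
    run s σ (suc i) = next (run s σ i) (σ i)

    behaviour : State → StreamFun m n
    behaviour s σ i = out (run s σ i) (σ i)

    run-shift : ∀ s u σ i → run s (u ∷ˢ σ) (suc i) ≡ run (next s u) σ i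
    run-shift s u σ zero    = refl
    run-shift s u σ (suc i) = cong (λ t → next t (σ i)) (run-shift s u σ i)

    run-causal : ∀ s {σ τ} i → (∀ {j} → j ℕ.< i → σ j ≡ τ j) → run s σ i ≡ run s τ i
    run-causal s zero    p = refl
    run-causal s (suc i) p =
      cong₂ next (run-causal s i (λ q → p (≤-trans q (n≤1+n i)))) (p ≤-refl)

    behaviour-causal : ∀ s → Causal (behaviour s)
    behaviour-causal s i p =
      cong₂ out (run-causal s i (λ {j} q → p (≤-trans (n≤1+n j) q))) (p ≤-refl)

    behaviour-derivative : ∀ s u → derivative (behaviour s) u ≋ behaviour (next s u)
    behaviour-derivative s u σ i = cong (λ t → out t (σ i)) (run-shift s u σ i)

    next* : State → List (V^ m) → State
    next* s []      = s
    next* s (u ∷ w) = next* (next s u) w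

    behaviour-derivative* : ∀ s w → derivative* (behaviour s) w ≋ behaviour (next* s w)
    behaviour-derivative* s []      σ i = refl
    behaviour-derivative* s (u ∷ w) σ i =
      trans (derivative*-cong (behaviour-derivative s u) w σ i)
            (behaviour-derivative* (next s u) w σ i)

    run-mono : ∀ {s t σ τ} → s ≤ t → σ ⊑ˢ τ → ∀ i → run s σ i ≤ run t τ i
    run-mono p q zero    = p
    run-mono p q (suc i) = proj₁ (step-monotone (run-mono p q i) (q i))

    behaviour-mono : ∀ {s t σ τ} → s ≤ t → σ ⊑ˢ τ → behaviour s σ ⊑ˢ behaviour t τ
    behaviour-mono p q i = out-mono (run-mono p q i) (q i)

  ! : ∀ {m n} → Mealy m n → StreamMor m n
  ! M .fun = Mealy.behaviour M (Mealy.init M)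
  ! M .causal = Mealy.behaviour-causal M (Mealy.init M)
  ! M .finitelySpecified =
    List.tabulate (behaviour ∘ Inverse.from (proj₂ finite)) , λ w →
    Any.tabulate⁺ (Inverse.to (proj₂ finite) (next* init w)) λ σ i →
      trans (behaviour-derivative* init w σ i)
            (cong (λ s → behaviour s σ i)
                  (sym (Inverse.strictlyInverseʳ (proj₂ finite) (next* init w))))
    where open Mealy M
  ! M .monotone = Mealy.behaviour-mono M (Mealy.≤-rfl M)
  ! M .⊥-preserving = record
    { bot          = behaviour ⊥ˢ
    ; bot-causal   = behaviour-causal ⊥ˢ
    ; bot-monotone = behaviour-mono ≤-rfl
    ; bot-below    = λ w σ i →
        ⊑ⱽ-trans (behaviour-mono (⊥ˢ-least _) (λ _ → ⊑ⱽ-refl) i)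
                 (⊑ⱽ-reflexive (sym (behaviour-derivative* init w σ i)))
    ; bot-step     = λ
        { σ zero    → cong proj₂ step-⊥
        ; σ (suc i) → trans (behaviour-derivative ⊥ˢ ⊥ⱽ σ i)
                            (cong (λ s → behaviour s σ i) (cong proj₁ step-⊥)) }
    }
    where open Mealy M

  open Mealy using (State; next; out; init)

  pure : ∀ {m n} → Func m n → Mealy m n
  pure f .Mealy.State = ⊤
  pure f .Mealy._≤_ _ _ = ⊤
  pure f .Mealy.isPartialOrder = record
    { isPreorder = record
        { isEquivalence = ≡-isEquivalence ; reflexive = λ _ → tt ; trans = λ _ _ → tt }
    ; antisym = λ _ _ → refl }
  pure f .Mealy.finite = 1 , ↔-sym Fin.1↔⊤
  pure f .Mealy.⊥ˢ = tt
  pure f .Mealy.⊥ˢ-least _ = tt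
  pure f .Mealy.init = tt
  pure f .Mealy.step (s , u) = s , Func.fun f u
  pure f .Mealy.step-monotone _ p = tt , Func.monotone f p
  pure f .Mealy.step-⊥ = cong (tt ,_) (Func.⊥-preserving f)

  ×-order : ∀ {A B : Set} {R : A → A → Set} {S : B → B → Set} →
            IsPartialOrder _≡_ R → IsPartialOrder _≡_ S →
            IsPartialOrder _≡_ (λ (p q : A × B) → R (proj₁ p) (proj₁ q) × S (proj₂ p) (proj₂ q))
  ×-order R S = record
    { isPreorder = record
        { isEquivalence = ≡-isEquivalence
        ; reflexive = λ { refl → R.refl , S.refl }
        ; trans = λ { (a , b) (c , d) → R.trans a c , S.trans b d } }
    ; antisym = λ { (a , b) (c , d) → cong₂ _,_ (R.antisym a c) (S.antisym b d) } }
    where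
    module R = IsPartialOrder R
    module S = IsPartialOrder S

  ×-finite : ∀ {A B : Set} → Finite A → Finite B → Finite (A × B)
  ×-finite (k , α) (l , β) = k ℕ.* l , ↔-trans (α ×-↔ β) (↔-sym Fin.*↔×)

  module _ {m n p} (M : Mealy m n) (N : Mealy n p) where
    private
      module M = Mealy M
      module N = Mealy N

    cascade : Mealy m p
    cascade .Mealy.State = M.State × N.State
    cascade .Mealy._≤_ (s , t) (s′ , t′) = s M.≤ s′ × t N.≤ t′
    cascade .Mealy.isPartialOrder = ×-order M.isPartialOrder N.isPartialOrder
    cascade .Mealy.finite = ×-finite M.finite N.finite
    cascade .Mealy.⊥ˢ = M.⊥ˢ , N.⊥ˢ
    cascade .Mealy.⊥ˢ-least (s , t) = M.⊥ˢ-least s , N.⊥ˢ-least t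
    cascade .Mealy.init = M.init , N.init
    cascade .Mealy.step ((s , t) , u) =
      (M.next s u , N.next t (M.out s u)) , N.out t (M.out s u)
    cascade .Mealy.step-monotone (p , q) r =
      let a , b = M.step-monotone p r
          c , d = N.step-monotone q b
      in (a , c) , d
    cascade .Mealy.step-⊥ =
      let e = trans (cong (λ u → N.step (N.⊥ˢ , u)) (cong proj₂ M.step-⊥)) N.step-⊥
      in cong₂ _,_ (cong₂ _,_ (cong proj₁ M.step-⊥) (cong proj₁ e)) (cong proj₂ e)

  module _ {m n p q} (M : Mealy m n) (N : Mealy p q) where
    private
      module M = Mealy M
      module N = Mealy N

    direct : Mealy (m + p) (n + q)
    direct .Mealy.State = M.State × N.State
    direct .Mealy._≤_ (s , t) (s′ , t′) = s M.≤ s′ × t N.≤ t′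
    direct .Mealy.isPartialOrder = ×-order M.isPartialOrder N.isPartialOrder
    direct .Mealy.finite = ×-finite M.finite N.finite
    direct .Mealy.⊥ˢ = M.⊥ˢ , N.⊥ˢ
    direct .Mealy.⊥ˢ-least (s , t) = M.⊥ˢ-least s , N.⊥ˢ-least t
    direct .Mealy.init = M.init , N.init
    direct .Mealy.step ((s , t) , u) =
      (M.next s (take m u) , N.next t (drop m u)) , M.out s (take m u) ++ N.out t (drop m u)
    direct .Mealy.step-monotone (p , q) r =
      let a , b = M.step-monotone p (take-mono m r)
          c , d = N.step-monotone q (drop-mono m r)
      in (a , c) , Pw.++⁺ b d
    direct .Mealy.step-⊥ =
      let e = trans (cong (λ u → M.step (M.⊥ˢ , u)) (take-replicate m p ●)) M.step-⊥
          f = trans (cong (λ u → N.step (N.⊥ˢ , u)) (drop-replicate m p ●)) N.step-⊥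
      in cong₂ _,_ (cong₂ _,_ (cong proj₁ e) (cong proj₁ f))
                   (trans (cong₂ _++_ (cong proj₂ e) (cong proj₂ f)) (replicate-++ n q ●))

  module Feedback (x : ℕ) {m n : ℕ} (M : Mealy (x + m) (x + n)) where
    private
      module M = Mealy M

    feed : M.State → V^ m → V^ x → V^ x
    feed s u r = take x (M.out s (r ++ u))

    feed-mono : ∀ {s t u v r q} → s M.≤ t → u ⊑ⱽ v → r ⊑ⱽ q → feed s u r ⊑ⱽ feed t v q
    feed-mono p q r = take-mono x (M.out-mono p (Pw.++⁺ r q))

    private
      module LFP s u = LeastFixedPoint (feed s u) (feed-mono M.≤-rfl ⊑ⱽ-refl)

    -- Kept abstract for type-checking speed; μ-isLeastFixedPoint determines μ.
    abstract
      μ : M.State → V^ m → V^ x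
      μ = LFP.lfp

      μ-isLeastFixedPoint : ∀ s u → IsLeastFixedPoint (feed s u) (μ s u)
      μ-isLeastFixedPoint s u = LFP.lfp-isLeastFixedPoint s u

      μ-fixed : ∀ s u → take x (M.out s (μ s u ++ u)) ≡ μ s u
      μ-fixed s u = LFP.lfp-fixed s u

      μ-least : ∀ s u {r} → take x (M.out s (r ++ u)) ⊑ⱽ r → μ s u ⊑ⱽ r
      μ-least s u = LFP.lfp-least-prefixed s u

    μ-mono : ∀ {s t u v} → s M.≤ t → u ⊑ⱽ v → μ s u ⊑ⱽ μ t v
    μ-mono {s} {t} {u} {v} p q =
      μ-least s u (⊑ⱽ-trans (feed-mono p q ⊑ⱽ-refl) (⊑ⱽ-reflexive (μ-fixed t v)))

    step-⊥-⊥ : M.step (M.⊥ˢ , ⊥ⱽ {x} ++ ⊥ⱽ {m}) ≡ (M.⊥ˢ , ⊥ⱽ)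
    step-⊥-⊥ = trans (cong (λ u → M.step (M.⊥ˢ , u)) (replicate-++ x m ●)) M.step-⊥

    μ-⊥ : μ M.⊥ˢ ⊥ⱽ ≡ ⊥ⱽ
    μ-⊥ = ⊑ⱽ-antisym
      (μ-least M.⊥ˢ ⊥ⱽ
        (⊑ⱽ-reflexive (trans (cong (take x) (cong proj₂ step-⊥-⊥)) (take-replicate x n ●))))
      (⊥ⱽ-least _)

  module _ (x : ℕ) {m n : ℕ} (M : Mealy (x + m) (x + n)) where
    private
      module M = Mealy M
    open Feedback x M

    traceᴹ : Mealy m n
    traceᴹ .Mealy.State = M.State
    traceᴹ .Mealy._≤_ = M._≤_
    traceᴹ .Mealy.isPartialOrder = M.isPartialOrder
    traceᴹ .Mealy.finite = M.finite
    traceᴹ .Mealy.⊥ˢ = M.⊥ˢ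
    traceᴹ .Mealy.⊥ˢ-least = M.⊥ˢ-least
    traceᴹ .Mealy.init = M.init
    traceᴹ .Mealy.step (s , u) = M.next s (μ s u ++ u) , drop x (M.out s (μ s u ++ u))
    traceᴹ .Mealy.step-monotone p q =
      let a , b = M.step-monotone p (Pw.++⁺ (μ-mono p q) q) in a , drop-mono x b
    traceᴹ .Mealy.step-⊥ =
      let e = trans (cong (λ r → M.step (M.⊥ˢ , r ++ ⊥ⱽ)) μ-⊥) step-⊥-⊥
      in cong₂ _,_ (cong proj₁ e) (trans (cong (drop x) (cong proj₂ e)) (drop-replicate x n ●))

  idᶠ : ∀ n → Func n n
  idᶠ n = record { fun = id ; monotone = id ; ⊥-preserving = refl }

  swapᶠ : ∀ m n → Func (m + n) (n + m)
  swapᶠ m n = record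
    { fun = swapⱽ m n ; monotone = swap-mono m n
    ; ⊥-preserving = trans (cong₂ _++_ (drop-replicate m n ●) (take-replicate m n ●))
                           (replicate-++ n m ●) }

  forkᶠ : Func 1 2
  forkᶠ = record
    { fun = λ { (v ∷ []) → v ∷ v ∷ [] }
    ; monotone = λ { (p ∷ []) → p ∷ p ∷ [] }
    ; ⊥-preserving = refl }

  joinᶠ : Func 2 1
  joinᶠ = record
    { fun = λ { (v ∷ w ∷ []) → (v ⊔ w) ∷ [] }
    ; monotone = λ
        { {v ∷ w ∷ []} {v′ ∷ w′ ∷ []} (p ∷ q ∷ []) →
          proj₂ (proj₂ (L.supremum v w)) (v′ ⊔ w′)
            (L.trans p (proj₁ (L.supremum v′ w′)))
            (L.trans q (proj₁ (proj₂ (L.supremum v′ w′)))) ∷ [] }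
    ; ⊥-preserving = cong (_∷ [])
        (L.antisym (proj₂ (proj₂ (L.supremum ● ●)) ● L.refl L.refl) (●-least _)) }

  elimᶠ : Func 1 0
  elimᶠ = record { fun = λ _ → [] ; monotone = λ _ → [] ; ⊥-preserving = refl }

  -- States: true is s_v and false is s_⊥.
  valueᴹ : V → Mealy 0 1
  valueᴹ v .Mealy.State = Bool
  valueᴹ v .Mealy._≤_ = Bool._≤_
  valueᴹ v .Mealy.isPartialOrder = Bool.≤-isPartialOrder
  valueᴹ v .Mealy.finite = 2 , ↔-sym Fin.2↔Bool
  valueᴹ v .Mealy.⊥ˢ = false
  valueᴹ v .Mealy.⊥ˢ-least = Bool.≤-minimum
  valueᴹ v .Mealy.init = true
  valueᴹ v .Mealy.step (s , _) = false , (if s then v else ●) ∷ []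
  valueᴹ v .Mealy.step-monotone Bool.f≤t _ = Bool.b≤b , ●-least _ ∷ []
  valueᴹ v .Mealy.step-monotone Bool.b≤b _ = Bool.b≤b , L.refl ∷ []
  valueᴹ v .Mealy.step-⊥ = refl

  delayᴹ : Mealy 1 1
  delayᴹ .Mealy.State = V
  delayᴹ .Mealy._≤_ = _⊑_
  delayᴹ .Mealy.isPartialOrder = L.isPartialOrder
  delayᴹ .Mealy.finite = V-finite
  delayᴹ .Mealy.⊥ˢ = ●
  delayᴹ .Mealy.⊥ˢ-least = ●-least
  delayᴹ .Mealy.init = ●
  delayᴹ .Mealy.step (v , (a ∷ [])) = a , v ∷ []
  delayᴹ .Mealy.step-monotone p (q ∷ []) = q , p ∷ []
  delayᴹ .Mealy.step-⊥ = refl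

  ⟦_⟧ᵍ : ∀ {m n} → SGen m n → Mealy m n
  ⟦ comb (prim p) ⟧ᵍ = pure ⟦ p ⟧ᵖ
  ⟦ comb fork ⟧ᵍ     = pure forkᶠ
  ⟦ comb join ⟧ᵍ     = pure joinᶠ
  ⟦ comb intro ⟧ᵍ    = valueᴹ ●
  ⟦ comb elim ⟧ᵍ     = pure elimᶠ
  ⟦ value v _ ⟧ᵍ     = valueᴹ v
  ⟦ delay ⟧ᵍ         = delayᴹ

  ⟦_⟧ᴹ : ∀ {m n} → SCircTerm m n → Mealy m n
  ⟦ gen g ⟧ᴹ    = ⟦ g ⟧ᵍ
  ⟦ idₘ n ⟧ᴹ    = pure (idᶠ n)
  ⟦ f ⨾ g ⟧ᴹ    = cascade ⟦ f ⟧ᴹ ⟦ g ⟧ᴹ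
  ⟦ f ⊗ g ⟧ᴹ    = direct ⟦ f ⟧ᴹ ⟦ g ⟧ᴹ
  ⟦ swap m n ⟧ᴹ = pure (swapᶠ m n)
  ⟦ Tr x f ⟧ᴹ   = traceᴹ x ⟦ f ⟧ᴹ

  ⟦_⟧ˢ : ∀ {m n} → SCircTerm m n → StreamMor m n
  ⟦ f ⟧ˢ = ! ⟦ f ⟧ᴹ

  infix 4 _≈ᴵ_
  _≈ᴵ_ : ∀ {m n} → SCircTerm m n → SCircTerm m n → Set
  f ≈ᴵ g = ⟦ f ⟧ˢ ≈ˢ ⟦ g ⟧ˢ

  module S = PROP StreamPROP

  cascade-run : ∀ {m n p} (M : Mealy m n) (N : Mealy n p) s t σ i →
    Mealy.run (cascade M N) (s , t) σ i ≡
    (Mealy.run M s σ i , Mealy.run N t (Mealy.behaviour M s σ) i)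
  cascade-run M N s t σ zero    = refl
  cascade-run M N s t σ (suc i) = cong (λ q → next (cascade M N) q (σ i)) (cascade-run M N s t σ i)

  cascade-behaviour : ∀ {m n p} (M : Mealy m n) (N : Mealy n p) s t →
    Mealy.behaviour (cascade M N) (s , t) ≋ Mealy.behaviour N t ∘ Mealy.behaviour M s
  cascade-behaviour M N s t σ i = cong (λ q → out (cascade M N) q (σ i)) (cascade-run M N s t σ i)

  !-cascade : ∀ {m n p} (M : Mealy m n) (N : Mealy n p) → ! (cascade M N) ≈ˢ (! M S.⨾ ! N)
  !-cascade M N = cascade-behaviour M N (init M) (init N)

  direct-run : ∀ {m n p q} (M : Mealy m n) (N : Mealy p q) s t σ i →
    Mealy.run (direct M N) (s , t) σ i ≡
    (Mealy.run M s (take m ∘ σ) i , Mealy.run N t (drop m ∘ σ) i)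
  direct-run M N s t σ zero    = refl
  direct-run M N s t σ (suc i) = cong (λ q → next (direct M N) q (σ i)) (direct-run M N s t σ i)

  direct-behaviour : ∀ {m n p q} (M : Mealy m n) (N : Mealy p q) s t →
    Mealy.behaviour (direct M N) (s , t) ≋ tensorFun (Mealy.behaviour M s) (Mealy.behaviour N t)
  direct-behaviour M N s t σ i = cong (λ q → out (direct M N) q (σ i)) (direct-run M N s t σ i)

  !-direct : ∀ {m n p q} (M : Mealy m n) (N : Mealy p q) → ! (direct M N) ≈ˢ (! M S.⊗ ! N)
  !-direct M N = direct-behaviour M N (init M) (init N)

  record Bisimulation {m n} (M N : Mealy m n) : Set₁ where
    field
      _~_    : State M → State N → Set
      ~-init : init M ~ init N
      ~-out  : ∀ {s t} → s ~ t → ∀ u → out M s u ≡ out N t u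
      ~-next : ∀ {s t} → s ~ t → ∀ u → next M s u ~ next N t u

    ~-run : ∀ {s t} → s ~ t → ∀ σ i → Mealy.run M s σ i ~ Mealy.run N t σ i
    ~-run p σ zero    = p
    ~-run p σ (suc i) = ~-next (~-run p σ i) (σ i)

    sound : ! M ≈ˢ ! N
    sound σ i = ~-out (~-run ~-init σ i) (σ i)

  bisimilar : ∀ {m n} (M N : Mealy m n) → Bisimulation M N → ! M ≈ˢ ! N
  bisimilar M N = Bisimulation.sound

  simulated-via : ∀ {m n} (M N : Mealy m n) (φ : State M → State N) →
                  φ (init M) ≡ init N →
                  (∀ s u → out M s u ≡ out N (φ s) u) →
                  (∀ s u → φ (next M s u) ≡ next N (φ s) u) →
                  ! M ≈ˢ ! N
  simulated-via M N φ φ-init φ-out φ-next = bisimilar M N record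
    { _~_ = λ s t → φ s ≡ t
    ; ~-init = φ-init
    ; ~-out = λ { {s} refl u → φ-out s u }
    ; ~-next = λ { {s} refl u → φ-next s u }
    }

  module _ {m m′ n n′} (p : m ≡ m′) (q : n ≡ n′) (M : Mealy m n) where
    private
      module M = Mealy M

    castᴹ : Mealy m′ n′
    castᴹ .Mealy.State = M.State
    castᴹ .Mealy._≤_ = M._≤_
    castᴹ .Mealy.isPartialOrder = M.isPartialOrder
    castᴹ .Mealy.finite = M.finite
    castᴹ .Mealy.⊥ˢ = M.⊥ˢ
    castᴹ .Mealy.⊥ˢ-least = M.⊥ˢ-least
    castᴹ .Mealy.init = M.init
    castᴹ .Mealy.step (s , u) = M.next s (cast (sym p) u) , cast q (M.out s (cast (sym p) u))
    castᴹ .Mealy.step-monotone a b =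
      let c , d = M.step-monotone a (cast-mono (sym p) b) in c , cast-mono q d
    castᴹ .Mealy.step-⊥ =
      let e = trans (cong (λ u → M.step (M.⊥ˢ , u)) (cast-⊥ (sym p))) M.step-⊥
      in cong₂ _,_ (cong proj₁ e) (trans (cong (cast q) (cong proj₂ e)) (cast-⊥ q))

  !-recast : ∀ {m m′ n n′} (p : m ≡ m′) (q : n ≡ n′) (f : SCircTerm m n) →
             ! ⟦ recast p q f ⟧ᴹ ≈ˢ ! (castᴹ p q ⟦ f ⟧ᴹ)
  !-recast refl refl f = bisimilar ⟦ f ⟧ᴹ (castᴹ refl refl ⟦ f ⟧ᴹ) record
    { _~_ = _≡_
    ; ~-init = refl
    ; ~-out = λ { {s} refl u → sym (trans (cast-is-id refl _) (cong (out ⟦ f ⟧ᴹ s) (cast-is-id refl u))) }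
    ; ~-next = λ { {s} refl u → sym (cong (next ⟦ f ⟧ᴹ s) (cast-is-id refl u)) }
    }

  μ-cong : ∀ x {m n m′ n′} (M : Mealy (x + m) (x + n)) (N : Mealy (x + m′) (x + n′)) {s t u v} →
           (∀ r → Feedback.feed x M s u r ≡ Feedback.feed x N t v r) →
           Feedback.μ x M s u ≡ Feedback.μ x N t v
  μ-cong x M N {s} {t} {u} {v} e = ⊑ⱽ-antisym
    (M.μ-least s u (⊑ⱽ-reflexive (trans (e _) (N.μ-fixed t v))))
    (N.μ-least t v (⊑ⱽ-reflexive (trans (sym (e _)) (M.μ-fixed s u))))
    where
    module M = Feedback x M
    module N = Feedback x N

  trace-cong : ∀ x {m n} (M N : Mealy (x + m) (x + n)) →
               ! M ≈ˢ ! N → ! (traceᴹ x M) ≈ˢ ! (traceᴹ x N)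
  trace-cong x M N e = bisimilar (traceᴹ x M) (traceᴹ x N) record
    { _~_ = λ s t → M.behaviour s ≋ N.behaviour t
    ; ~-init = e
    ; ~-out = λ {s} {t} p u → cong (drop x)
        (trans (out≡ p _) (cong (λ r → N.out t (r ++ u)) (μ≡ p)))
    ; ~-next = λ {s} {t} p u σ i →
        trans (sym (M.behaviour-derivative s _ σ i))
        (trans (p _ (suc i))
        (trans (N.behaviour-derivative t _ σ i)
               (cong (λ r → N.behaviour (N.next t (r ++ u)) σ i) (μ≡ p))))
    }
    where
    module M = Mealy M
    module N = Mealy N
    out≡ : ∀ {s t} → M.behaviour s ≋ N.behaviour t → ∀ u → M.out s u ≡ N.out t u
    out≡ p u = p (λ _ → u) 0
    μ≡ : ∀ {s t} → M.behaviour s ≋ N.behaviour t → ∀ {u} → Feedback.μ x M s u ≡ Feedback.μ x N t u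
    μ≡ p = μ-cong x M N (λ r → cong (take x) (out≡ p _))

  sound-tightening : ∀ x {m m′ n n′}
    (G : Mealy m m′) (F : Mealy (x + m′) (x + n′)) (H : Mealy n′ n) →
    ! (traceᴹ x (cascade (cascade (direct (pure (idᶠ x)) G) F) (direct (pure (idᶠ x)) H))) ≈ˢ
    ! (cascade (cascade G (traceᴹ x F)) H)
  sound-tightening x G F H = simulated-via L R φ refl out≡ next≡
    where
    T = cascade (cascade (direct (pure (idᶠ x)) G) F) (direct (pure (idᶠ x)) H)
    o : State G → State F → V^ _ → V^ x → V^ _
    o g f u r = out F f (take x (r ++ u) ++ out G g (drop x (r ++ u)))
    i-eq : ∀ (g : State G) u (r : V^ x) → take x (r ++ u) ++ out G g (drop x (r ++ u)) ≡ r ++ out G g u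
    i-eq g u r = cong₂ _++_ (take-++ r u) (cong (out G g) (drop-++ r u))
    μ : State G → State F → State H → V^ _ → V^ x
    μ g f h u = Feedback.μ x T (((tt , g) , f) , (tt , h)) u
    μ≡ : ∀ (g : State G) (f : State F) (h : State H) u → μ g f h u ≡ Feedback.μ x F f (out G g u)
    μ≡ g f h u = μ-cong x T F (λ r →
      trans (take-++ (take x (o g f u r)) (out H h (drop x (o g f u r)))) (cong (λ z → take x (out F f z)) (i-eq g u r)))
    i≡ : ∀ (g : State G) (f : State F) (h : State H) u → take x (μ g f h u ++ u) ++ out G g (drop x (μ g f h u ++ u)) ≡
                     Feedback.μ x F f (out G g u) ++ out G g u
    i≡ g f h u = trans (i-eq g u _) (cong (_++ out G g u) (μ≡ g f h u))
    o≡ : ∀ (g : State G) (f : State F) (h : State H) u → o g f u (μ g f h u) ≡ out F f (Feedback.μ x F f (out G g u) ++ out G g u)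
    o≡ g f h u = cong (out F f) (i≡ g f h u)
    L = traceᴹ x T
    R = cascade (cascade G (traceᴹ x F)) H
    φ : State L → State R
    φ (((_ , g) , f) , (_ , h)) = (g , f) , h
    out≡ : ∀ s u → out L s u ≡ out R (φ s) u
    out≡ (((_ , g) , f) , (_ , h)) u =
      trans (drop-++ (take x (o g f u (μ g f h u))) (out H h (drop x (o g f u (μ g f h u)))))
            (cong (λ z → out H h (drop x z)) (o≡ g f h u))
    next≡ : ∀ s u → φ (next L s u) ≡ next R (φ s) u
    next≡ (((_ , g) , f) , (_ , h)) u = cong₂ _,_
      (cong₂ _,_ (cong (next G g) (drop-++ (μ g f h u) u)) (cong (next F f) (i≡ g f h u)))
      (cong (λ z → next H h (drop x z)) (o≡ g f h u))

  sound-sliding : ∀ x y {m n} (F : Mealy (x + m) (y + n)) (G : Mealy y x) →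
    ! (traceᴹ x (cascade F (direct G (pure (idᶠ n))))) ≈ˢ
    ! (traceᴹ y (cascade (direct G (pure (idᶠ m))) F))
  sound-sliding x y {m} {n} F G = simulated-via M₁′ M₂′ φ refl out≡ next≡
    where
    M₁ = cascade F (direct G (pure (idᶠ n)))
    M₂ = cascade (direct G (pure (idᶠ m))) F
    μ₁ : ∀ (f : State F) (g : State G) (u : V^ m) → V^ x
    μ₁ f g u = Feedback.μ x M₁ (f , (g , tt)) u
    μ₂ : ∀ (f : State F) (g : State G) (u : V^ m) → V^ y
    μ₂ f g u = Feedback.μ y M₂ ((g , tt) , f) u
    eq₁ : ∀ (f : State F) (g : State G) (u : V^ m) r → Feedback.feed x M₁ (f , (g , tt)) u r ≡ out G g (take y (out F f (r ++ u)))
    eq₁ f g u r = take-++ (out G g (take y (out F f (r ++ u)))) (drop y (out F f (r ++ u)))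
    eq₂ : ∀ (f : State F) (g : State G) (u : V^ m) r → Feedback.feed y M₂ ((g , tt) , f) u r ≡ take y (out F f (out G g r ++ u))
    eq₂ f g u r = cong (λ z → take y (out F f z))
                       (cong₂ _++_ (cong (out G g) (take-++ r u)) (drop-++ r u))
    fix₁ : ∀ (f : State F) (g : State G) (u : V^ m) → out G g (take y (out F f (μ₁ f g u ++ u))) ≡ μ₁ f g u
    fix₁ f g u = trans (sym (eq₁ f g u (μ₁ f g u))) (Feedback.μ-fixed x M₁ (f , (g , tt)) u)
    fix₂ : ∀ (f : State F) (g : State G) (u : V^ m) → take y (out F f (out G g (μ₂ f g u) ++ u)) ≡ μ₂ f g u
    fix₂ f g u = trans (sym (eq₂ f g u (μ₂ f g u))) (Feedback.μ-fixed y M₂ ((g , tt) , f) u)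
    μ₁≡ : ∀ (f : State F) (g : State G) (u : V^ m) → μ₁ f g u ≡ out G g (μ₂ f g u)
    μ₁≡ f g u = ⊑ⱽ-antisym
      (Feedback.μ-least x M₁ (f , (g , tt)) u
        (⊑ⱽ-reflexive (trans (eq₁ f g u (out G g (μ₂ f g u))) (cong (out G g) (fix₂ f g u)))))
      (⊑ⱽ-trans
        (Mealy.out-mono G (Mealy.≤-rfl G)
          (Feedback.μ-least y M₂ ((g , tt) , f) u
            (⊑ⱽ-reflexive (trans (eq₂ f g u (take y (out F f (μ₁ f g u ++ u))))
              (cong (λ r → take y (out F f (r ++ u))) (fix₁ f g u))))))
        (⊑ⱽ-reflexive (fix₁ f g u)))
    μ₂≡ : ∀ (f : State F) (g : State G) (u : V^ m) → μ₂ f g u ≡ take y (out F f (μ₁ f g u ++ u))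
    μ₂≡ f g u = trans (sym (fix₂ f g u))
                      (cong (λ r → take y (out F f (r ++ u))) (sym (μ₁≡ f g u)))
    i≡ : ∀ (f : State F) (g : State G) (u : V^ m) → μ₁ f g u ++ u ≡
                   out G g (take y (μ₂ f g u ++ u)) ++ drop y (μ₂ f g u ++ u)
    i≡ f g u = cong₂ _++_
      (trans (μ₁≡ f g u) (cong (out G g) (sym (take-++ (μ₂ f g u) u))))
      (sym (drop-++ (μ₂ f g u) u))
    M₁′ = traceᴹ x M₁
    M₂′ = traceᴹ y M₂
    φ : State M₁′ → State M₂′
    φ (f , (g , _)) = (g , tt) , f
    out≡ : ∀ s u → out M₁′ s u ≡ out M₂′ (φ s) u
    out≡ (f , (g , _)) u =
      trans (drop-++ (out G g (take y (out F f (μ₁ f g u ++ u)))) (drop y (out F f (μ₁ f g u ++ u))))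
            (cong (λ z → drop y (out F f z)) (i≡ f g u))
    next≡ : ∀ s u → φ (next M₁′ s u) ≡ next M₂′ (φ s) u
    next≡ (f , (g , _)) u = cong₂ _,_
      (cong (_, tt) (cong (next G g) (trans (sym (μ₂≡ f g u)) (sym (take-++ (μ₂ f g u) u)))))
      (cong (next F f) (i≡ f g u))

  sound-vanishing₀ : ∀ {m n} (M : Mealy m n) → ! (traceᴹ 0 M) ≈ˢ ! M
  sound-vanishing₀ M = simulated-via (traceᴹ 0 M) M id refl
    (λ s u → cong (out M s) (nil (Feedback.μ 0 M s u) u))
    (λ s u → cong (next M s) (nil (Feedback.μ 0 M s u) u))
    where
    nil : ∀ {m} (r : V^ 0) (u : V^ m) → r ++ u ≡ u
    nil [] u = refl

  take-assoc : ∀ m n p (v : V^ (m + (n + p))) →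
               take (m + n) (cast-assoc⁻ m n p v) ≡ take m v ++ take n (drop m v)
  take-assoc m n p v =
    trans (sym (take++drop≡id m _)) (cong₂ _++_ (take-take m n p v) (drop-take m n p v))

  sound-vanishing₊ : ∀ x y {m n} (M : Mealy (x + (y + m)) (x + (y + n))) →
    ! (traceᴹ (x + y) (castᴹ (sym (+-assoc x y m)) (sym (+-assoc x y n)) M)) ≈ˢ
    ! (traceᴹ y (traceᴹ x M))
  sound-vanishing₊ x y {m} {n} M = simulated-via (traceᴹ (x + y) M′) (traceᴹ y (traceᴹ x M)) id refl
    (λ s u → trans (drop-drop x y n (out M s (cast-assoc x y m (A s u ++ u))))
                   (cong (λ z → drop y (drop x (out M s z))) (i≡ s u)))
    (λ s u → cong (next M s) (i≡ s u))
    where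
    M′ = castᴹ (sym (+-assoc x y m)) (sym (+-assoc x y n)) M
    module F′ = Feedback (x + y) M′
    module X  = Feedback x M
    module Y  = Feedback y (traceᴹ x M)
    module _ (s : State M) (u : V^ m) where
      B : V^ y
      B = Y.μ s u
      C : V^ x
      C = X.μ s (B ++ u)
      A : V^ (x + y)
      A = F′.μ s u
      a₁ = take x A
      a₂ = drop x A
      feed≡ : ∀ (c : V^ x) (b : V^ y) → F′.feed s u (c ++ b) ≡
              take x (out M s (c ++ (b ++ u))) ++ take y (drop x (out M s (c ++ (b ++ u))))
      feed≡ c b = trans (take-assoc x y n _)
        (cong (λ z → take x (out M s z) ++ take y (drop x (out M s z))) (++-assoc-eqFree c b u))
      fix : take x (out M s (a₁ ++ (a₂ ++ u))) ++ take y (drop x (out M s (a₁ ++ (a₂ ++ u)))) ≡ A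
      fix = trans (sym (feed≡ a₁ a₂))
                  (trans (cong (F′.feed s u) (take++drop≡id x A)) (F′.μ-fixed s u))
      fix₁ : take x (out M s (a₁ ++ (a₂ ++ u))) ≡ a₁
      fix₁ = trans (sym (take-++ _ _)) (cong (take x) fix)
      fix₂ : take y (drop x (out M s (a₁ ++ (a₂ ++ u)))) ≡ a₂
      fix₂ = trans (sym (drop-++ (take x (out M s (a₁ ++ (a₂ ++ u)))) _)) (cong (drop x) fix)
      X⊑a₁ : X.μ s (a₂ ++ u) ⊑ⱽ a₁
      X⊑a₁ = X.μ-least s _ (⊑ⱽ-reflexive fix₁)
      B⊑a₂ : B ⊑ⱽ a₂
      B⊑a₂ = Y.μ-least s u
        (⊑ⱽ-trans (take-mono y (drop-mono x (Mealy.out-mono M (Mealy.≤-rfl M) (Pw.++⁺ X⊑a₁ ⊑ⱽ-refl))))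
                  (⊑ⱽ-reflexive fix₂))
      C⊑a₁ : C ⊑ⱽ a₁
      C⊑a₁ = ⊑ⱽ-trans (X.μ-mono (Mealy.≤-rfl M) (Pw.++⁺ B⊑a₂ ⊑ⱽ-refl)) X⊑a₁
      A≡ : A ≡ C ++ B
      A≡ = ⊑ⱽ-antisym
        (F′.μ-least s u (⊑ⱽ-reflexive
          (trans (feed≡ C B) (cong₂ _++_ (X.μ-fixed s (B ++ u)) (Y.μ-fixed s u)))))
        (⊑ⱽ-trans (Pw.++⁺ C⊑a₁ B⊑a₂) (⊑ⱽ-reflexive (take++drop≡id x A)))
      i≡ : cast (sym (sym (+-assoc x y m))) (A ++ u) ≡ C ++ (B ++ u)
      i≡ = trans (cong (λ z → cast-assoc x y m (z ++ u)) A≡) (++-assoc-eqFree C B u)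

  sound-superposing : ∀ x {m n} (M : Mealy (x + m) (x + n)) p →
    ! (traceᴹ x (castᴹ (+-assoc x m p) (+-assoc x n p) (direct M (pure (idᶠ p))))) ≈ˢ
    ! (direct (traceᴹ x M) (pure (idᶠ p)))
  sound-superposing x {m} {n} M p = simulated-via L R id refl out≡ next≡
    where
    M′ = castᴹ (+-assoc x m p) (+-assoc x n p) (direct M (pure (idᶠ p)))
    μ : State M → V^ (m + p) → V^ x
    μ s u = Feedback.μ x M′ (s , tt) u
    split : ∀ (v : V^ (x + n)) (w : V^ p) →
            cast-assoc x n p (v ++ w) ≡ take x v ++ (drop x v ++ w)
    split v w = trans (cong (λ z → cast-assoc x n p (z ++ w)) (sym (take++drop≡id x v)))
                      (++-assoc-eqFree (take x v) (drop x v) w)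
    take-cast : ∀ (v : V^ (x + n)) (w : V^ p) → take x (cast-assoc x n p (v ++ w)) ≡ take x v
    take-cast v w = trans (cong (take x) (split v w)) (take-++ (take x v) _)
    drop-cast : ∀ (v : V^ (x + n)) (w : V^ p) → drop x (cast-assoc x n p (v ++ w)) ≡ drop x v ++ w
    drop-cast v w = trans (cong (drop x) (split v w)) (drop-++ (take x v) _)
    in≡ : ∀ (r : V^ x) (u : V^ (m + p)) →
          take (x + m) (cast-assoc⁻ x m p (r ++ u)) ≡ r ++ take m u
    in≡ r u = trans (take-assoc x m p (r ++ u))
                    (cong₂ _++_ (take-++ r u) (cong (take m) (drop-++ r u)))
    μ≡ : ∀ (s : State M) (u : V^ (m + p)) → μ s u ≡ Feedback.μ x M s (take m u)
    μ≡ s u = μ-cong x M′ M (λ r →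
      trans (take-cast (out M s _) _) (cong (λ z → take x (out M s z)) (in≡ r u)))
    i≡ : ∀ (s : State M) (u : V^ (m + p)) → take (x + m) (cast-assoc⁻ x m p (μ s u ++ u)) ≡
                 Feedback.μ x M s (take m u) ++ take m u
    i≡ s u = trans (in≡ (μ s u) u) (cong (_++ take m u) (μ≡ s u))
    L = traceᴹ x M′
    R = direct (traceᴹ x M) (pure (idᶠ p))
    out≡ : ∀ s u → out L s u ≡ out R s u
    out≡ (s , _) u =
      trans (drop-cast (out M s (take (x + m) (cast-assoc⁻ x m p (μ s u ++ u))))
                       (drop (x + m) (cast-assoc⁻ x m p (μ s u ++ u))))
      (cong₂ _++_ (cong (λ z → drop x (out M s z)) (i≡ s u))
                  (trans (drop-drop x m p (μ s u ++ u)) (cong (drop m) (drop-++ (μ s u) u))))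
    next≡ : ∀ s u → next L s u ≡ next R s u
    next≡ (s , _) u = cong (λ z → next M s z , tt) (i≡ s u)

  sound-yanking : ∀ x → ! (traceᴹ x (pure (swapᶠ x x))) ≈ˢ ! (pure (idᶠ x))
  sound-yanking x = bisimilar (traceᴹ x M) (pure (idᶠ x)) record
    { _~_ = λ _ _ → ⊤
    ; ~-init = tt
    ; ~-out = λ _ u → trans (cong (drop x) (swapⱽ-++ (μ u) u)) (trans (drop-++ u (μ u)) (μ≡ u))
    ; ~-next = λ _ _ → tt
    }
    where
    M = pure (swapᶠ x x)
    μ : V^ x → V^ x
    μ u = Feedback.μ x M tt u
    μ≡ : ∀ u → μ u ≡ u
    μ≡ u = trans (sym (Feedback.μ-fixed x M tt u))
                 (trans (cong (take x) (swapⱽ-++ (μ u) u)) (take-++ u (μ u)))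

  infixr 5 _∙_
  _∙_ : ∀ {m n} {f g h : StreamFun m n} → f ≋ g → g ≋ h → f ≋ h
  (p ∙ q) σ i = trans (p σ i) (q σ i)

  inv : ∀ {m n} {f g : StreamFun m n} → f ≋ g → g ≋ f
  inv p σ i = sym (p σ i)

  ⟦⟧-⨾ : ∀ {m n p} (f : SCircTerm m n) (g : SCircTerm n p) → ⟦ f ⨾ g ⟧ˢ ≈ˢ (⟦ f ⟧ˢ S.⨾ ⟦ g ⟧ˢ)
  ⟦⟧-⨾ f g = !-cascade ⟦ f ⟧ᴹ ⟦ g ⟧ᴹ

  ⟦⟧-⊗ : ∀ {m n p q} (f : SCircTerm m n) (g : SCircTerm p q) → ⟦ f ⊗ g ⟧ˢ ≈ˢ (⟦ f ⟧ˢ S.⊗ ⟦ g ⟧ˢ)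
  ⟦⟧-⊗ f g = !-direct ⟦ f ⟧ᴹ ⟦ g ⟧ᴹ

  ⟦⟧-recast : ∀ {m m′ n n′} (p : m ≡ m′) (q : n ≡ n′) (f : SCircTerm m n) (g : StreamMor m n) →
              ⟦ f ⟧ˢ ≈ˢ g → ⟦ recast p q f ⟧ˢ ≈ˢ S.recast p q g
  ⟦⟧-recast refl refl f g e = e

  ⨾-≈ : ∀ {m n p} (f f′ : StreamMor m n) (g g′ : StreamMor n p) →
        f ≈ˢ f′ → g ≈ˢ g′ → (f S.⨾ g) ≈ˢ (f′ S.⨾ g′)
  ⨾-≈ f f′ g g′ = S.⨾-cong {f = f} {f′} {g} {g′}

  ⊗-≈ : ∀ {m n p q} (f f′ : StreamMor m n) (g g′ : StreamMor p q) →
        f ≈ˢ f′ → g ≈ˢ g′ → (f S.⊗ g) ≈ˢ (f′ S.⊗ g′)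
  ⊗-≈ f f′ g g′ = S.⊗-cong {f = f} {f′} {g} {g′}

  ≈ᴵ-⨾ : ∀ {m n p} {f f′ : SCircTerm m n} {g g′ : SCircTerm n p} →
         f ≈ᴵ f′ → g ≈ᴵ g′ → f ⨾ g ≈ᴵ f′ ⨾ g′
  ≈ᴵ-⨾ {f = f} {f′} {g} {g′} p q =
    ⟦⟧-⨾ f g ∙ ⨾-≈ ⟦ f ⟧ˢ ⟦ f′ ⟧ˢ ⟦ g ⟧ˢ ⟦ g′ ⟧ˢ p q ∙ inv (⟦⟧-⨾ f′ g′)

  ≈ᴵ-⊗ : ∀ {m n p q} {f f′ : SCircTerm m n} {g g′ : SCircTerm p q} →
         f ≈ᴵ f′ → g ≈ᴵ g′ → f ⊗ g ≈ᴵ f′ ⊗ g′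
  ≈ᴵ-⊗ {f = f} {f′} {g} {g′} p q =
    ⟦⟧-⊗ f g ∙ ⊗-≈ ⟦ f ⟧ˢ ⟦ f′ ⟧ˢ ⟦ g ⟧ˢ ⟦ g′ ⟧ˢ p q ∙ inv (⟦⟧-⊗ f′ g′)

  ≈ᴵ-equivalence : ∀ {m n} → IsEquivalence (_≈ᴵ_ {m} {n})
  ≈ᴵ-equivalence = record
    { refl = λ σ i → refl ; sym = λ p → inv p ; trans = λ p q → p ∙ q }

  ≃⇒≈ᴵ : ∀ {m n} {f g : SCircTerm m n} → f ≃ g → f ≈ᴵ g
  ≃⇒≈ᴵ ≃-refl        = λ σ i → refl
  ≃⇒≈ᴵ (≃-sym p)     = inv (≃⇒≈ᴵ p)
  ≃⇒≈ᴵ (≃-trans p q) = ≃⇒≈ᴵ p ∙ ≃⇒≈ᴵ q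
  ≃⇒≈ᴵ (⨾-cong {f = f} {f′} {g} {g′} p q) = ≈ᴵ-⨾ {f = f} {f′} {g} {g′} (≃⇒≈ᴵ p) (≃⇒≈ᴵ q)
  ≃⇒≈ᴵ (⊗-cong {f = f} {f′} {g} {g′} p q) = ≈ᴵ-⊗ {f = f} {f′} {g} {g′} (≃⇒≈ᴵ p) (≃⇒≈ᴵ q)
  ≃⇒≈ᴵ (Tr-cong x {f = f} {f′} p) = trace-cong x ⟦ f ⟧ᴹ ⟦ f′ ⟧ᴹ (≃⇒≈ᴵ p)
  ≃⇒≈ᴵ (⨾-idˡ {m} f) = ⟦⟧-⨾ (idₘ m) f
  ≃⇒≈ᴵ (⨾-idʳ {n = n} f) = ⟦⟧-⨾ f (idₘ n)
  ≃⇒≈ᴵ (⨾-assoc f g h) =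
    ⟦⟧-⨾ (f ⨾ g) h ∙
    ⨾-≈ ⟦ f ⨾ g ⟧ˢ (⟦ f ⟧ˢ S.⨾ ⟦ g ⟧ˢ) ⟦ h ⟧ˢ ⟦ h ⟧ˢ (⟦⟧-⨾ f g) (λ _ _ → refl) ∙
    inv (⟦⟧-⨾ f (g ⨾ h) ∙ λ σ → ⟦⟧-⨾ g h (fun ⟦ f ⟧ˢ σ))
  ≃⇒≈ᴵ (⊗-id m n) = ⟦⟧-⊗ (idₘ m) (idₘ n) ∙ S.⊗-id m n
  ≃⇒≈ᴵ (⊗-⨾ f g f′ g′) =
    ⟦⟧-⊗ (f ⨾ g) (f′ ⨾ g′) ∙
    ⊗-≈ ⟦ f ⨾ g ⟧ˢ (⟦ f ⟧ˢ S.⨾ ⟦ g ⟧ˢ) ⟦ f′ ⨾ g′ ⟧ˢ (⟦ f′ ⟧ˢ S.⨾ ⟦ g′ ⟧ˢ) (⟦⟧-⨾ f g) (⟦⟧-⨾ f′ g′) ∙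
    S.⊗-⨾ ⟦ f ⟧ˢ ⟦ g ⟧ˢ ⟦ f′ ⟧ˢ ⟦ g′ ⟧ˢ ∙
    inv (⟦⟧-⨾ (f ⊗ f′) (g ⊗ g′) ∙
         ⨾-≈ ⟦ f ⊗ f′ ⟧ˢ (⟦ f ⟧ˢ S.⊗ ⟦ f′ ⟧ˢ) ⟦ g ⊗ g′ ⟧ˢ (⟦ g ⟧ˢ S.⊗ ⟦ g′ ⟧ˢ) (⟦⟧-⊗ f f′) (⟦⟧-⊗ g g′))
  ≃⇒≈ᴵ (⊗-unitˡ f) = ⟦⟧-⊗ (idₘ 0) f
  ≃⇒≈ᴵ (⊗-unitʳ {m} {n} f) =
    ⟦⟧-recast (+-identityʳ m) (+-identityʳ n) (f ⊗ idₘ 0) (⟦ f ⟧ˢ S.⊗ S.idₘ 0) (⟦⟧-⊗ f (idₘ 0)) ∙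
    S.⊗-unitʳ ⟦ f ⟧ˢ
  ≃⇒≈ᴵ (⊗-assoc {m} {n} {p} {q} {r} {s} f g h) =
    ⟦⟧-recast (+-assoc m p r) (+-assoc n q s) ((f ⊗ g) ⊗ h) ((⟦ f ⟧ˢ S.⊗ ⟦ g ⟧ˢ) S.⊗ ⟦ h ⟧ˢ)
      (⟦⟧-⊗ (f ⊗ g) h ∙
       ⊗-≈ ⟦ f ⊗ g ⟧ˢ (⟦ f ⟧ˢ S.⊗ ⟦ g ⟧ˢ) ⟦ h ⟧ˢ ⟦ h ⟧ˢ (⟦⟧-⊗ f g) (λ _ _ → refl)) ∙
    S.⊗-assoc ⟦ f ⟧ˢ ⟦ g ⟧ˢ ⟦ h ⟧ˢ ∙
    inv (⟦⟧-⊗ f (g ⊗ h) ∙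
         ⊗-≈ ⟦ f ⟧ˢ ⟦ f ⟧ˢ ⟦ g ⊗ h ⟧ˢ (⟦ g ⟧ˢ S.⊗ ⟦ h ⟧ˢ) (λ _ _ → refl) (⟦⟧-⊗ g h))
  ≃⇒≈ᴵ (swap-natural {m} {n} {p} {q} f g) =
    ⟦⟧-⨾ (f ⊗ g) (swap n q) ∙
    ⨾-≈ ⟦ f ⊗ g ⟧ˢ (⟦ f ⟧ˢ S.⊗ ⟦ g ⟧ˢ) ⟦ swap n q ⟧ˢ (S.swap n q) (⟦⟧-⊗ f g) (λ _ _ → refl) ∙
    S.swap-natural ⟦ f ⟧ˢ ⟦ g ⟧ˢ ∙
    inv (⟦⟧-⨾ (swap m p) (g ⊗ f) ∙ λ σ → ⟦⟧-⊗ g f (fun ⟦ swap m p ⟧ˢ σ))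
  ≃⇒≈ᴵ (swap-involutive m n) = ⟦⟧-⨾ (swap m n) (swap n m) ∙ S.swap-involutive m n
  ≃⇒≈ᴵ (swap-hexagon m n p) =
    S.swap-hexagon m n p ∙
    inv (⟦⟧-⨾ l r ∙
      ⨾-≈ ⟦ l ⟧ˢ (S.recast (+-assoc m n p) (+-assoc n m p) (S.swap m n S.⊗ S.idₘ p))
          ⟦ r ⟧ˢ (S.recast refl (sym (+-assoc n p m)) (S.idₘ n S.⊗ S.swap m p))
        (⟦⟧-recast (+-assoc m n p) (+-assoc n m p) (swap m n ⊗ idₘ p) (S.swap m n S.⊗ S.idₘ p)
          (⟦⟧-⊗ (swap m n) (idₘ p)))
        (⟦⟧-recast refl (sym (+-assoc n p m)) (idₘ n ⊗ swap m p) (S.idₘ n S.⊗ S.swap m p)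
          (⟦⟧-⊗ (idₘ n) (swap m p))))
    where
    l = recast (+-assoc m n p) (+-assoc n m p) (swap m n ⊗ idₘ p)
    r = recast refl (sym (+-assoc n p m)) (idₘ n ⊗ swap m p)
  ≃⇒≈ᴵ (tightening x g f h) = sound-tightening x ⟦ g ⟧ᴹ ⟦ f ⟧ᴹ ⟦ h ⟧ᴹ
  ≃⇒≈ᴵ (sliding x y f g) = sound-sliding x y ⟦ f ⟧ᴹ ⟦ g ⟧ᴹ
  ≃⇒≈ᴵ (vanishing₀ f) = sound-vanishing₀ ⟦ f ⟧ᴹ
  ≃⇒≈ᴵ (vanishing₊ x y {m} {n} f) =
    trace-cong (x + y) ⟦ recast p q f ⟧ᴹ (castᴹ p q ⟦ f ⟧ᴹ) (!-recast p q f) ∙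
    sound-vanishing₊ x y ⟦ f ⟧ᴹ
    where
    p = sym (+-assoc x y m)
    q = sym (+-assoc x y n)
  ≃⇒≈ᴵ (superposing x {m} {n} f p) =
    trace-cong x ⟦ recast a b (f ⊗ idₘ p) ⟧ᴹ (castᴹ a b ⟦ f ⊗ idₘ p ⟧ᴹ) (!-recast a b (f ⊗ idₘ p)) ∙
    sound-superposing x ⟦ f ⟧ᴹ p
    where
    a = +-assoc x m p
    b = +-assoc x n p
  ≃⇒≈ᴵ (yanking x) = sound-yanking x

  ≈ᴵ-congruence : Congruence SCirc
  ≈ᴵ-congruence = record
    { _∼_ = _≈ᴵ_
    ; ∼-equivalence = ≈ᴵ-equivalence
    ; ≈⇒∼ = ≃⇒≈ᴵ
    ; ∼-⨾ = λ {_} {_} {_} {f} {f′} {g} {g′} → ≈ᴵ-⨾ {f = f} {f′} {g} {g′}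
    ; ∼-⊗ = λ {_} {_} {_} {_} {f} {f′} {g} {g′} → ≈ᴵ-⊗ {f = f} {f′} {g} {g′}
    }

  SCirc/≈ : PROP
  SCirc/≈ = SCirc / ≈ᴵ-congruence

  record IsComplete : Set where
    field
      ‖_‖   : ∀ {m n} → Func m n → ConstForm m n
      ‖‖-⟦⟧ : ∀ {m n} (f : Func m n) (σ : Stream (V^ m)) (i : ℕ) →
              fun ⟦ ConstForm.circuit ‖ f ‖ ⟧ˢ σ i ≡ Func.fun f (σ i)

{-# OPTIONS --safe #-}
-- Denotational equivalence makes the denotation faithful, so it is enough to
-- realise every stream function f by a circuit.  Finite specification yields a
-- deterministic automaton whose states are derivatives of f; its transitions need
-- not be monotone.  The machine built here runs on sets of states instead: from X
-- on input u it moves to all successors of states of X along inputs a ⊑ u, and it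
-- outputs the join of the corresponding outputs.  This is monotone, and maps the
-- empty set and ⊥ to the empty set and ⊥.  As f is monotone, the derivative of f
-- along the word read so far lies in the current set and dominates all of its
-- elements, so the join is the output of f.  A set of k states is a vector in V^k,
-- and completeness turns the step function into a circuit, which is closed up
-- with a register and a trace.
module Submission where

open import Defs
open import Data.Fin.Base as Fin using (Fin)
import Data.Fin.Properties as Fin
open import Data.List.Base as List using (List; []; _∷_; length)
open import Data.List.Membership.Propositional using (_∈_)
open import Data.List.Membership.Propositional.Properties
  using (∈-allFin; ∈-cartesianProduct⁺; ∈-cartesianProductWith⁺; ∈-cartesianProductWith⁻; ∈-lookup;
    ∈-filter⁺; ∈-filter⁻; ∈-tabulate⁺)
import Data.List.Properties as List
open import Data.List.Relation.Unary.Any as Any using (here; there)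
open import Data.List.Relation.Unary.Any.Properties using (lookup-index)
open import Data.Nat.Base as ℕ using (ℕ; zero; suc; _+_; _≤_; _<_; s≤s; z≤n)
import Data.Nat.Properties as ℕ
open import Data.Product.Base using (_×_; _,_; proj₁; proj₂; ∃-syntax)
open import Data.Sum.Base using (_⊎_; inj₁; inj₂)
open import Data.Unit.Base using (tt)
open import Data.Vec.Base using ([]; _∷_; _++_; take; drop; lookup; zipWith; _[_]≔_)
open import Data.Vec.Properties
  using (take++drop≡id; lookup-zipWith; lookup-replicate; lookup∘update; lookup∘update′)
open import Data.Vec.Relation.Binary.Pointwise.Inductive as Pw using ([]; _∷_)
open import Function.Base using (_∘_; id)
open import Function.Bundles using (Inverse)
open import Relation.Binary.Lattice.Bundles using (JoinSemilattice)
open import Relation.Binary.Lattice.Structures using (IsLattice)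
import Relation.Binary.Lattice.Properties.JoinSemilattice as JoinSemilatticeProperties
open import Relation.Binary.Definitions using (Decidable)
open import Relation.Binary.PropositionalEquality
  using (_≡_; _≢_; refl; sym; trans; cong; cong₂; subst; isEquivalence)
open import Relation.Binary.Structures using (IsEquivalence)
open import Relation.Nullary.Decidable using (decidable-stable)
open import Relation.Nullary using (¬_; yes; no; ¬?; _×-dec_; contradiction)
import Relation.Unary as Unary

open StreamFunctions

-- Isomorphisms of PROPs from faithful morphisms with a section on homs.

faithful+split⇒≅ : ∀ {P Q} (F : PROPMorphism P Q) →
  let open PROPMorphism F; module P = PROP P; module Q = PROP Q in
  (∀ {m n} {f g : P.Hom m n} → map f Q.≈ map g → f P.≈ g) →
  (section : ∀ {m n} → Q.Hom m n → P.Hom m n) →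
  (∀ {m n} (h : Q.Hom m n) → map (section h) Q.≈ h) →
  P ≅ᴾ Q
faithful+split⇒≅ {P} {Q} F faithful section split = record
  { to      = F
  ; from    = record
    { map      = section
    ; map-cong = λ {_} {_} {f} {g} p → faithful (split f ∙ p ∙ inv (split g))
    ; map-id   = λ n → faithful (split (Q.idₘ n) ∙ inv (map-id n))
    ; map-⨾    = λ f g → faithful (split (f Q.⨾ g) ∙
        inv (map-⨾ (section f) (section g) ∙ Q.⨾-cong (split f) (split g)))
    ; map-⊗    = λ f g → faithful (split (f Q.⊗ g) ∙
        inv (map-⊗ (section f) (section g) ∙ Q.⊗-cong (split f) (split g)))
    ; map-swap = λ m n → faithful (split (Q.swap m n) ∙ inv (map-swap m n))
    }
  ; from∘to = λ f → faithful (split (map f))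
  ; to∘from = split
  }
  where
  open PROPMorphism F
  module Q = PROP Q
  infixr 5 _∙_
  _∙_ : ∀ {m n} {f g h : Q.Hom m n} → f Q.≈ g → g Q.≈ h → f Q.≈ h
  _∙_ = IsEquivalence.trans Q.isEquivalence
  inv : ∀ {m n} {f g : Q.Hom m n} → f Q.≈ g → g Q.≈ f
  inv = IsEquivalence.sym Q.isEquivalence

-- Finite automata from finitely specified stream functions.

module _ {A : Set} where

  wordsUpTo : List A → ℕ → List (List A)
  wordsUpTo as zero    = [] ∷ []
  wordsUpTo as (suc k) = [] ∷ List.cartesianProductWith _∷_ as (wordsUpTo as k)

  ∈-wordsUpTo : ∀ {as} → (∀ a → a ∈ as) → ∀ {k} w → length w ≤ k → w ∈ wordsUpTo as k
  ∈-wordsUpTo all {zero}  []      _       = here refl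
  ∈-wordsUpTo all {suc k} []      _       = here refl
  ∈-wordsUpTo all {suc k} (a ∷ w) (s≤s p) =
    there (∈-cartesianProductWith⁺ _∷_ (all a) (∈-wordsUpTo all w p))

  length-∈-wordsUpTo : ∀ {as k w} → w ∈ wordsUpTo as k → length w ≤ k
  length-∈-wordsUpTo {k = zero}       (here refl) = z≤n
  length-∈-wordsUpTo {k = suc k}      (here refl) = z≤n
  length-∈-wordsUpTo {as} {suc k} (there w∈)
    with ∈-cartesianProductWith⁻ _∷_ as (wordsUpTo as k) w∈
  ... | _ , _ , _ , v∈ , refl = s≤s (length-∈-wordsUpTo v∈)

  excise : ℕ → ℕ → List A → List A
  excise i j w = List.take i w List.++ List.drop j w

  length-excise : ∀ {i j} w → i < j → j ≤ length w → length (excise i j w) < length w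
  length-excise {i} {j} w i<j j≤ = begin-strict
    length (excise i j w)
      ≡⟨ List.length-++ (List.take i w) ⟩
    length (List.take i w) + length (List.drop j w)
      ≡⟨ cong₂ _+_ (List.length-take i w) (List.length-drop j w) ⟩
    i ℕ.⊓ length w + (length w ℕ.∸ j)
      ≤⟨ ℕ.+-monoˡ-≤ _ (ℕ.m⊓n≤m i _) ⟩
    i + (length w ℕ.∸ j)
      <⟨ ℕ.+-monoˡ-< _ i<j ⟩
    j + (length w ℕ.∸ j)
      ≡⟨ ℕ.m+[n∸m]≡n j≤ ⟩
    length w ∎
    where open ℕ.≤-Reasoning

  module _ {B : Set} where

    derivative*-resp-≋ : {f g : Stream A → Stream B} → f ≋ g →
                         ∀ w → derivative* f w ≋ derivative* g w
    derivative*-resp-≋ p []      = p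
    derivative*-resp-≋ p (a ∷ w) = derivative*-resp-≋ (λ σ i → p (a ∷ˢ σ) (suc i)) w

    derivative*-++ : (f : Stream A → Stream B) → ∀ u v →
                     derivative* f (u List.++ v) ≡ derivative* (derivative* f u) v
    derivative*-++ f []      v = refl
    derivative*-++ f (a ∷ u) v = derivative*-++ (derivative f a) u v

    -- An entry of the list in `FinitelySpecified` need not be a derivative of `f`. The states
    -- constructed below are therefore words of bounded length, each standing for the derivative
    -- along it.
    record FiniteDerivatives (f : Stream A → Stream B) : Set where
      field
        size     : ℕ
        state    : Fin size → Stream A → Stream B
        δ        : Fin size → A → Fin size
        initial  : Fin size
        state-δ  : ∀ q a → derivative (state q) a ≋ state (δ q a)
        state-initial : f ≋ state initial

    module _ {as : List A} (all : ∀ a → a ∈ as) {f : Stream A → Stream B}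
             (fs : FinitelySpecified f) where
      private
        K : ℕ
        K = length (proj₁ fs)

        index : List A → Fin K
        index w = Any.index (proj₂ fs w)

        index-injective : ∀ u v → index u ≡ index v → derivative* f u ≋ derivative* f v
        index-injective u v e σ i =
          trans (lookup-index (proj₂ fs u) σ i)
          (trans (cong (λ j → List.lookup (proj₁ fs) j σ i) e)
                 (sym (lookup-index (proj₂ fs v) σ i)))

      -- The derivative along `w` depends on a prefix only through the derivative along that prefix.
      excise-repetition : ∀ {i j} w → index (List.take i w) ≡ index (List.take j w) →
                          derivative* f w ≋ derivative* f (excise i j w)
      excise-repetition {i} {j} w e σ t =
        trans (cong (λ z → derivative* f z σ t) (sym (List.take++drop≡id j w)))
        (trans (cong (λ h → h σ t) (derivative*-++ f (List.take j w) (List.drop j w)))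
        (trans (derivative*-resp-≋ (index-injective (List.take j w) (List.take i w) (sym e)) (List.drop j w) σ t)
               (cong (λ h → h σ t) (sym (derivative*-++ f (List.take i w) (List.drop j w))))))

      -- By the pigeonhole principle, two prefixes of a word of length K + 1 have
      -- the same derivative, so the segment between them can be cut out.
      shorten : ∀ w → length w ≤ suc K →
                ∃[ w′ ] length w′ ≤ K × derivative* f w ≋ derivative* f w′
      shorten w l with ℕ.m≤n⇒m<n∨m≡n l
      ... | inj₁ (s≤s l′) = w , l′ , λ _ _ → refl
      -- The prefixes of lengths 0 to `K` number `K + 1`, while there are only `K` indices.
      ... | inj₂ l≡ with Fin.pigeonhole (ℕ.n<1+n K) (λ i → index (List.take (Fin.toℕ i) w))
      ...   | i , j , i<j , e =
        excise (Fin.toℕ i) (Fin.toℕ j) w ,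
        ℕ.≤-pred (subst (length (excise (Fin.toℕ i) (Fin.toℕ j) w) <_) l≡
                        (length-excise w i<j j≤)) ,
        excise-repetition w e
        where
        j≤ : Fin.toℕ j ≤ length w
        j≤ = subst (Fin.toℕ j ≤_) (sym l≡) (ℕ.<⇒≤ (Fin.toℕ<n j))

      private
        words : List (List A)
        words = wordsUpTo as K

        word : Fin (length words) → List A
        word = List.lookup words

        length-word : ∀ q → length (word q) ≤ K
        length-word q = length-∈-wordsUpTo (∈-lookup {xs = words} q)

        -- The bound `suc K` leaves room for one more letter after the word of a state, which is
        -- what a transition reads.
        find : ∀ w → length w ≤ suc K → ∃[ q ] derivative* f w ≋ derivative* f (word q)
        find w l with shorten w l
        ... | w′ , l′ , e = Any.index w∈ , λ σ i →
          trans (e σ i) (cong (λ z → derivative* f z σ i) (lookup-index w∈))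
          where w∈ = ∈-wordsUpTo all w′ l′

      finiteDerivatives : FiniteDerivatives f
      finiteDerivatives = record
        { size    = length words
        ; state   = λ q → derivative* f (word q)
        ; δ       = λ q a → proj₁ (next q a)
        ; initial = proj₁ (find [] z≤n)
        ; state-δ = λ q a σ i →
            trans (cong (λ h → h σ i) (sym (derivative*-++ f (word q) (a ∷ []))))
                  (proj₂ (next q a) σ i)
        ; state-initial = proj₂ (find [] z≤n)
        }
        where
        next : ∀ q a → ∃[ q′ ] derivative* f (word q List.++ a ∷ []) ≋ derivative* f (word q′)
        next q a = find (word q List.++ a ∷ [])
          (ℕ.≤-trans (ℕ.≤-reflexive (trans (List.length-++ (word q)) (ℕ.+-comm _ 1)))
                     (s≤s (length-word q)))

-- Finite joins of values and the monotone functions they define.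

module _ (Sg : Signature) (I : Interpretation Sg) where
  open Signature Sg
  open Interpretation I
  open Circuits Sg
  open Semantics Sg I
  open StreamMor using (fun)
  private
    module L = IsLattice isLattice

    joinSemilattice : JoinSemilattice _ _ _
    joinSemilattice = record { isJoinSemilattice = L.isJoinSemilattice }

  -- `v ⊑ w` amounts to `v ⊔ w ≡ w`, and equality of values is decidable.
  _⊑?_ : Decidable _⊑_
  _⊑?_ = JoinSemilatticeProperties.≈-dec⇒≤-dec joinSemilattice _≟_

  _⊑ⱽ?_ : ∀ {n} → Decidable (_⊑ⱽ_ {n})
  _⊑ⱽ?_ = Pw.decidable _⊑?_

  ≢●-mono : ∀ {v w} → v ⊑ w → v ≢ ● → w ≢ ●
  ≢●-mono v⊑w v≢● refl = v≢● (L.antisym v⊑w (●-least _))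

  ●-⊔ : ∀ v → ● ⊔ v ≡ v
  ●-⊔ v = L.antisym (L.∨-least (●-least v) L.refl) (L.y≤x∨y ● v)

  ⊔-● : ∀ v → v ⊔ ● ≡ v
  ⊔-● v = L.antisym (L.∨-least L.refl (●-least v)) (L.x≤x∨y v ●)

  allⱽ : ∀ m → List (V^ m)
  allⱽ m = List.tabulate (Inverse.from (proj₂ (V^-finite m)))

  ∈-allⱽ : ∀ {m} (u : V^ m) → u ∈ allⱽ m
  ∈-allⱽ {m} u = subst (_∈ allⱽ m) (Inverse.strictlyInverseʳ (proj₂ (V^-finite m)) u)
                       (∈-tabulate⁺ (Inverse.to (proj₂ (V^-finite m)) u))

  infixr 6 _⊔ⱽ_
  _⊔ⱽ_ : ∀ {n} → V^ n → V^ n → V^ n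
  _⊔ⱽ_ = zipWith _⊔_

  ⊔ⱽ-upperˡ : ∀ {n} (u v : V^ n) → u ⊑ⱽ u ⊔ⱽ v
  ⊔ⱽ-upperˡ []      []      = []
  ⊔ⱽ-upperˡ (x ∷ u) (y ∷ v) = L.x≤x∨y x y ∷ ⊔ⱽ-upperˡ u v

  ⊔ⱽ-upperʳ : ∀ {n} (u v : V^ n) → v ⊑ⱽ u ⊔ⱽ v
  ⊔ⱽ-upperʳ []      []      = []
  ⊔ⱽ-upperʳ (x ∷ u) (y ∷ v) = L.y≤x∨y x y ∷ ⊔ⱽ-upperʳ u v

  ⊔ⱽ-least : ∀ {n} {u v w : V^ n} → u ⊑ⱽ w → v ⊑ⱽ w → u ⊔ⱽ v ⊑ⱽ w
  ⊔ⱽ-least []       []       = []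
  ⊔ⱽ-least (p ∷ ps) (q ∷ qs) = L.∨-least p q ∷ ⊔ⱽ-least ps qs

  module _ {A : Set} {n : ℕ} (h : A → V^ n) where

    ⨆ : List A → V^ n
    ⨆ []       = ⊥ⱽ
    ⨆ (a ∷ as) = h a ⊔ⱽ ⨆ as

    ⨆-upper : ∀ as {a} → a ∈ as → h a ⊑ⱽ ⨆ as
    ⨆-upper (a ∷ as) (here refl) = ⊔ⱽ-upperˡ (h a) (⨆ as)
    ⨆-upper (b ∷ as) (there a∈)  = ⊑ⱽ-trans (⨆-upper as a∈) (⊔ⱽ-upperʳ (h b) (⨆ as))

    ⨆-least : ∀ as {u} → (∀ {a} → a ∈ as → h a ⊑ⱽ u) → ⨆ as ⊑ⱽ u
    ⨆-least []       p = ⊥ⱽ-least _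
    ⨆-least (a ∷ as) p = ⊔ⱽ-least (p (here refl)) (⨆-least as (p ∘ there))

    -- A join of `●`s is `●`, so searching the list finds a contributor. This traces a member of a
    -- successor set back to a transition.
    ⨆-≢● : ∀ as i → lookup (⨆ as) i ≢ ● → ∃[ a ] a ∈ as × lookup (h a) i ≢ ●
    ⨆-≢● []       i p = contradiction (lookup-replicate i ●) p
    ⨆-≢● (a ∷ as) i p with lookup (h a) i ≟ ●
    ... | no  q = a , here refl , q
    ... | yes q with ⨆-≢● as i (λ r → p
            (trans (lookup-zipWith _⊔_ i (h a) (⨆ as)) (trans (cong₂ _⊔_ q r) (⊔-● ●))))
    ...   | b , b∈ , r = b , there b∈ , r

  module _ {A : Set} (as : List A) {m : ℕ} {Active : A → V^ m → Set}
           (active? : ∀ a → Unary.Decidable (Active a)) where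

    active : V^ m → List A
    active u = List.filter (λ a → active? a u) as

    ∈-active⁺ : ∀ {a u} → a ∈ as → Active a u → a ∈ active u
    ∈-active⁺ {u = u} = ∈-filter⁺ (λ a → active? a u)

    ∈-active⁻ : ∀ {a u} → a ∈ active u → a ∈ as × Active a u
    ∈-active⁻ {u = u} = ∈-filter⁻ (λ a → active? a u) {xs = as}

    -- Raising `u` only adds terms to the join, and at `⊥ⱽ` the join is empty. An arbitrary `h` thus
    -- yields a `Func`.
    ⨆-active : (∀ {a u v} → u ⊑ⱽ v → Active a u → Active a v) → (∀ {a} → ¬ Active a ⊥ⱽ) →
               ∀ {n} → (A → V^ n) → Func m n
    ⨆-active active-mono ¬active-⊥ h = record
      { fun          = λ u → ⨆ h (active u)
      ; monotone     = λ {u} {v} u⊑v → ⨆-least h (active u) λ a∈ →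
          let a∈as , act = ∈-active⁻ {u = u} a∈ in
          ⨆-upper h (active v) (∈-active⁺ a∈as (active-mono u⊑v act))
      ; ⊥-preserving = ⊑ⱽ-antisym
          (⨆-least h (active ⊥ⱽ) λ a∈ → contradiction (proj₂ (∈-active⁻ {u = ⊥ⱽ} a∈)) ¬active-⊥)
          (⊥ⱽ-least _)
      }

  pairᶠ : ∀ {m n p} → Func m n → Func m p → Func m (n + p)
  pairᶠ {n = n} {p} f g = record
    { fun          = λ u → Func.fun f u ++ Func.fun g u
    ; monotone     = λ q → Pw.++⁺ (Func.monotone f q) (Func.monotone g q)
    ; ⊥-preserving = trans (cong₂ _++_ (Func.⊥-preserving f) (Func.⊥-preserving g))
                           (replicate-++ n p ●)
    }

  -- Registers, guarded feedback and coinduction.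

  register : ∀ {n} → V^ n → Mealy n n
  register {n} v .Mealy.State = V^ n
  register v .Mealy._≤_ = _⊑ⱽ_
  register v .Mealy.isPartialOrder = record
    { isPreorder = record
        { isEquivalence = isEquivalence
        ; reflexive = ⊑ⱽ-reflexive ; trans = ⊑ⱽ-trans }
    ; antisym = ⊑ⱽ-antisym }
  register {n} v .Mealy.finite = V^-finite n
  register v .Mealy.⊥ˢ = ⊥ⱽ
  register v .Mealy.⊥ˢ-least = ⊥ⱽ-least
  register v .Mealy.init = v
  register v .Mealy.step (s , u) = u , s
  register v .Mealy.step-monotone p q = q , p
  register v .Mealy.step-⊥ = refl

  !-register : ∀ {n} (v : V^ n) σ i → fun (! (register v)) σ i ≡ (v ∷ˢ σ) i
  !-register v σ zero    = refl
  !-register v σ (suc i) = refl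

  val₁-⟦⟧ : ∀ v σ i → fun ⟦ val₁ v ⟧ˢ σ i ≡ ((v ∷ []) ∷ˢ λ _ → ⊥ⱽ) i
  val₁-⟦⟧ v σ i with v ≟ ●
  val₁-⟦⟧ v σ zero    | yes refl = refl
  val₁-⟦⟧ v σ (suc i) | yes refl = refl
  val₁-⟦⟧ v σ zero    | no _     = refl
  val₁-⟦⟧ v σ (suc i) | no _     = refl

  delay-⟦⟧ : ∀ σ i → fun ⟦ gen delay ⟧ˢ σ i ≡ (⊥ⱽ ∷ˢ σ) i
  delay-⟦⟧ σ i = trans (out-delay (Mealy.run delayᴹ ● σ i) (σ i)) (run-delay i)
    where
    out-delay : ∀ s u → Mealy.out delayᴹ s u ≡ s ∷ []
    out-delay s (a ∷ []) = refl
    next-delay : ∀ s u → Mealy.next delayᴹ s u ∷ [] ≡ u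
    next-delay s (a ∷ []) = refl
    run-delay : ∀ i → Mealy.run delayᴹ ● σ i ∷ [] ≡ (⊥ⱽ ∷ˢ σ) i
    run-delay zero    = refl
    run-delay (suc i) = next-delay (Mealy.run delayᴹ ● σ i) (σ i)

  reg₁ : V → SCircTerm 1 1
  reg₁ v = (val₁ v ⊗ gen delay) ⨾ gen (comb join)

  reg₁-⟦⟧ : ∀ v σ i → fun ⟦ reg₁ v ⟧ˢ σ i ≡ ((v ∷ []) ∷ˢ σ) i
  reg₁-⟦⟧ v σ i =
    trans (⟦⟧-⨾ (val₁ v ⊗ gen delay) (gen (comb join)) σ i)
    (trans (cong (Func.fun joinᶠ)
      (trans (⟦⟧-⊗ (val₁ v) (gen delay) σ i)
             (cong₂ _++_ (val₁-⟦⟧ v (take 0 ∘ σ) i) (delay-⟦⟧ σ i))))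
    (glue i))
    where
    join-⊥ : ∀ (u : V^ 1) → Func.fun joinᶠ (⊥ⱽ {1} ++ u) ≡ u
    join-⊥ (a ∷ []) = cong (_∷ []) (●-⊔ a)
    glue : ∀ i → Func.fun joinᶠ (((v ∷ []) ∷ˢ λ _ → ⊥ⱽ) i ++ (⊥ⱽ ∷ˢ σ) i) ≡ ((v ∷ []) ∷ˢ σ) i
    -- The stored value appears at time 0 and the delayed input afterwards; the other argument of
    -- the join is `●`, which is neutral.
    glue zero    = cong (_∷ []) (⊔-● v)
    glue (suc i) = join-⊥ (σ i)

  -- A tensor of one-wire registers, unlike `reg`, avoids the swaps and recasts by which `joins`
  -- interleaves wires.
  regs : ∀ {n} → V^ n → SCircTerm n n
  regs []      = idₘ 0
  regs (v ∷ u) = reg₁ v ⊗ regs u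

  regs-⟦⟧ : ∀ {n} (u : V^ n) σ i → fun ⟦ regs u ⟧ˢ σ i ≡ (u ∷ˢ σ) i
  regs-⟦⟧ []      σ i = 0-unique _ _
    where
    0-unique : (u v : V^ 0) → u ≡ v
    0-unique [] [] = refl
  regs-⟦⟧ (v ∷ u) σ i =
    trans (⟦⟧-⊗ (reg₁ v) (regs u) σ i)
    (trans (cong₂ _++_ (reg₁-⟦⟧ v (take 1 ∘ σ) i) (regs-⟦⟧ u (drop 1 ∘ σ) i)) (glue i))
    where
    glue : ∀ i → ((v ∷ []) ∷ˢ (take 1 ∘ σ)) i ++ (u ∷ˢ (drop 1 ∘ σ)) i ≡ ((v ∷ u) ∷ˢ σ) i
    glue zero    = refl
    glue (suc i) = take++drop≡id 1 (σ i)

  feedbackᴹ : ∀ {k m n} → V^ k → Func (k + m) (k + n) → Mealy m n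
  feedbackᴹ {k} {m} s F = traceᴹ k (cascade (direct (register s) (pure (idᶠ m))) (pure F))

  module _ {k m n : ℕ} (s₀ : V^ k) (F : Func (k + m) (k + n)) where
    private
      N : Mealy (k + m) (k + n)
      N = cascade (direct (register s₀) (pure (idᶠ m))) (pure F)
      μ : V^ k → V^ m → V^ k
      μ s u = Feedback.μ k N ((s , tt) , tt) u

    -- The register emits its stored state whatever is fed back, so `μ` does not reach `F`.
    feedbackᴹ-out : ∀ s u → Mealy.out (feedbackᴹ s₀ F) ((s , tt) , tt) u ≡
                            drop k (Func.fun F (s ++ u))
    feedbackᴹ-out s u = cong (λ z → drop k (Func.fun F (s ++ z))) (drop-++ (μ s u) u)

    -- The register stores `μ`, which the fixed-point equation identifies with the first `k` outputs
    -- of `F`.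
    feedbackᴹ-next : ∀ s u → Mealy.next (feedbackᴹ s₀ F) ((s , tt) , tt) u ≡
                             ((take k (Func.fun F (s ++ u)) , tt) , tt)
    feedbackᴹ-next s u = cong (λ z → (z , tt) , tt)
      (trans (take-++ (μ s u) u)
      (trans (sym (Feedback.μ-fixed k N ((s , tt) , tt) u))
             (cong (λ z → take k (Func.fun F (s ++ z))) (drop-++ (μ s u) u))))

  -- Induction on time: position `suc i` of a stream function is position `i` of its derivative by
  -- the first letter. Causality supplies congruence, as `σ` and `σ 0 ∷ˢ tl σ` agree only pointwise.
  coinduction : ∀ {m n} (M : Mealy m n) (R : Mealy.State M → StreamFun m n → Set) →
    (∀ {s f} → R s f → Causal f) →
    (∀ {s f} → R s f → ∀ u → Mealy.out M s u ≡ f (λ _ → u) 0) →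
    (∀ {s f} → R s f → ∀ u → R (Mealy.next M s u) (derivative f u)) →
    ∀ {s f} → R s f → Mealy.behaviour M s ≋ f
  coinduction M R R-causal R-out R-next = go
    where
    go : ∀ {s f} → R s f → Mealy.behaviour M s ≋ f
    go r σ zero = trans (R-out r (σ 0)) (R-causal r 0 λ { {zero} _ → refl ; {suc _} () })
    go {s} {f} r σ (suc i) =
      trans (Mealy.behaviour-causal M s (suc i) (λ {j} _ → uncons j))
      (trans (Mealy.behaviour-derivative M s (σ 0) (tl σ) i)
      (trans (go (R-next r (σ 0)) (tl σ) i)
             (sym (R-causal r (suc i) (λ {j} _ → uncons j)))))
      where
      uncons : ∀ j → σ j ≡ (σ 0 ∷ˢ tl σ) j
      uncons zero    = refl
      uncons (suc j) = refl

  -- The subset machine and its correctness.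

  module SubsetMachine {m n : ℕ} (top : V) (top≢● : top ≢ ●)
                       {f : StreamFun m n} (D : FiniteDerivatives f) where
    open FiniteDerivatives D renaming (size to k)

    -- A vector in V^ k encodes the subset of states whose coordinate differs from ●.
    singleton : Fin k → V^ k
    singleton q = ⊥ⱽ [ q ]≔ top

    -- Testing for `≢ ●` rather than for equality with `top` makes membership upward closed; `top`
    -- is any value other than `●`, not necessarily the greatest.
    _∋_ : V^ k → Fin k → Set
    s ∋ q = lookup s q ≢ ●

    ∋-mono : ∀ {s t} → s ⊑ⱽ t → ∀ {q} → s ∋ q → t ∋ q
    ∋-mono p {q} = ≢●-mono (Pw.lookup p q)

    singleton-∋ : ∀ q → singleton q ∋ q
    singleton-∋ q p = top≢● (trans (sym (lookup∘update q ⊥ⱽ top)) p)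

    ∋-singleton : ∀ {q r} → singleton q ∋ r → r ≡ q
    ∋-singleton {q} {r} p with r Fin.≟ q
    ... | yes e = e
    ... | no  e = contradiction (trans (lookup∘update′ e ⊥ⱽ top) (lookup-replicate r ●)) p

    transitions : List (Fin k × V^ m)
    transitions = List.cartesianProduct (List.allFin k) (allⱽ m)

    Active : Fin k × V^ m → V^ (k + m) → Set
    Active (q , a) x = take k x ∋ q × a ⊑ⱽ drop k x

    active? : ∀ t → Unary.Decidable (Active t)
    active? (q , a) x = ¬? (lookup (take k x) q ≟ ●) ×-dec (a ⊑ⱽ? drop k x)

    active-mono : ∀ {t x y} → x ⊑ⱽ y → Active t x → Active t y
    active-mono p (q∈ , a⊑) = ∋-mono (take-mono k p) q∈ , ⊑ⱽ-trans a⊑ (drop-mono k p)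

    ¬active-⊥ : ∀ {t} → ¬ Active t ⊥ⱽ
    ¬active-⊥ {q , a} (q∈ , _) =
      q∈ (trans (cong (λ s → lookup s q) (take-replicate k m ●)) (lookup-replicate q ●))

    enabled : V^ (k + m) → List (Fin k × V^ m)
    enabled = active transitions active?

    next-singleton : Fin k × V^ m → V^ k
    next-singleton (q , a) = singleton (δ q a)

    output : Fin k × V^ m → V^ n
    output (q , a) = state q (λ _ → a) 0

    sup : ∀ {p} → (Fin k × V^ m → V^ p) → Func (k + m) p
    sup = ⨆-active transitions active? (λ {t} → active-mono {t}) (λ {t} → ¬active-⊥ {t})

    stepᶠ : Func (k + m) (k + n)
    stepᶠ = pairᶠ (sup next-singleton) (sup output)

    ∈-enabled⁺ : ∀ {s u q a} → s ∋ q → a ⊑ⱽ u → (q , a) ∈ enabled (s ++ u)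
    ∈-enabled⁺ {s} {u} {q} {a} q∈ a⊑ = ∈-active⁺ transitions active?
      (∈-cartesianProduct⁺ (∈-allFin q) (∈-allⱽ a))
      ( subst (_∋ q) (sym (take-++ s u)) q∈ , subst (a ⊑ⱽ_) (sym (drop-++ s u)) a⊑ )

    ∈-enabled⁻ : ∀ {s u q a} → (q , a) ∈ enabled (s ++ u) → s ∋ q × a ⊑ⱽ u
    ∈-enabled⁻ {s} {u} {q} {a} t∈
      with _ , q∈ , a⊑ ← ∈-active⁻ transitions active? {u = s ++ u} t∈ =
      subst (_∋ q) (take-++ s u) q∈ , subst (a ⊑ⱽ_) (drop-++ s u) a⊑

    -- The relation for `coinduction`: `g` is what remains of `f`. The fields on `current` bound the
    -- output join from below, and `bound` bounds it from above.
    record Tracks (s : V^ k) (g : StreamFun m n) : Set where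
      field
        causal   : Causal g
        monotone : Monotone g
        current  : Fin k
        current∈ : s ∋ current
        current≋ : g ≋ state current
        bound    : ∀ {q} → s ∋ q → state q ⊑ᶠ g

    machine : Mealy m n
    machine = feedbackᴹ (singleton initial) stepᶠ

    ∷ˢ-⊑ : ∀ {p} {a u : V^ p} → a ⊑ⱽ u → ∀ σ → (a ∷ˢ σ) ⊑ˢ (u ∷ˢ σ)
    ∷ˢ-⊑ p σ zero    = p
    ∷ˢ-⊑ p σ (suc i) = ⊑ⱽ-refl

    -- From above: an enabled `(q , a)` has `state q ⊑ᶠ g` and `a ⊑ⱽ u`, and `g` is monotone. From
    -- below: `(current , u)` is itself enabled.
    tracks-out : ∀ {s g} → Tracks s g → ∀ u →
                 Func.fun (sup output) (s ++ u) ≡ g (λ _ → u) 0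
    tracks-out {s} {g} T u = ⊑ⱽ-antisym
      (⨆-least output (enabled (s ++ u)) λ {t} t∈ → let q∈ , a⊑ = ∈-enabled⁻ {s} {u} t∈ in
        ⊑ⱽ-trans (bound q∈ (λ _ → proj₂ t) 0) (monotone (λ _ → a⊑) 0))
      (⊑ⱽ-trans (⊑ⱽ-reflexive (current≋ (λ _ → u) 0))
                (⨆-upper output (enabled (s ++ u)) (∈-enabled⁺ current∈ ⊑ⱽ-refl)))
      where open Tracks T

    tracks-next : ∀ {s g} → Tracks s g → ∀ u →
                  Tracks (Func.fun (sup next-singleton) (s ++ u)) (derivative g u)
    tracks-next {s} {g} T u = record
      { causal   = derivative-causal causal u
      ; monotone = λ {σ} {τ} p i → monotone (λ { zero → ⊑ⱽ-refl ; (suc j) → p j }) (suc i)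
      ; current  = δ current u
      ; current∈ = ∋-mono (⨆-upper next-singleton (enabled (s ++ u)) (∈-enabled⁺ current∈ ⊑ⱽ-refl))
                          (singleton-∋ (δ current u))
      ; current≋ = λ σ i → trans (current≋ (u ∷ˢ σ) (suc i)) (state-δ current u σ i)
      ; bound    = bound′
      }
      where
      open Tracks T
      bound′ : ∀ {q} → Func.fun (sup next-singleton) (s ++ u) ∋ q → state q ⊑ᶠ derivative g u
      -- A new member `q` is `δ p a` for an enabled `(p , a)`. The derivative of `state p` by `a`
      -- lies below that of `g` by `a`, hence below that of `g` by `u`.
      bound′ {q} q∈ σ i with ⨆-≢● next-singleton (enabled (s ++ u)) q q∈
      ... | (p , a) , t∈ , q∈′ with ∋-singleton q∈′ | ∈-enabled⁻ {s} {u} t∈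
      ...   | refl | p∈ , a⊑ =
        ⊑ⱽ-trans (⊑ⱽ-reflexive (sym (state-δ p a σ i)))
        (⊑ⱽ-trans (bound p∈ (a ∷ˢ σ) (suc i)) (monotone (∷ˢ-⊑ a⊑ σ) (suc i)))

    correct : Causal f → Monotone f → fun (! machine) ≋ f
    correct f-causal f-mono = coinduction machine
      (λ { ((s , _) , _) g → Tracks s g }) Tracks.causal
      (λ { {(s , _) , _} T u →
        trans (feedbackᴹ-out (singleton initial) stepᶠ s u)
        (trans (drop-++ (Func.fun (sup next-singleton) (s ++ u)) _) (tracks-out T u)) })
      (λ { {(s , _) , _} {g} T u →
        subst (λ { ((s′ , _) , _) → Tracks s′ (derivative g u) })
          (sym (trans (feedbackᴹ-next (singleton initial) stepᶠ s u)
                      (cong (λ s′ → (s′ , tt) , tt)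
                            (take-++ (Func.fun (sup next-singleton) (s ++ u)) _))))
          (tracks-next T u) })
      record
        { causal = f-causal ; monotone = f-mono
        ; current = initial ; current∈ = singleton-∋ initial ; current≋ = state-initial
        ; bound = λ {q} q∈ σ i → subst (λ r → state r σ i ⊑ⱽ f σ i) (sym (∋-singleton q∈))
                                       (⊑ⱽ-reflexive (sym (state-initial σ i)))
        }

  -- Synthesis of circuits from a complete interpretation.

  module Synthesis (complete : IsComplete) where
    open IsComplete complete

    feedback : ∀ {k m n} → V^ k → Func (k + m) (k + n) → SCircTerm m n
    feedback {k} {m} s F = Tr k ((regs s ⊗ idₘ m) ⨾ ConstForm.circuit ‖ F ‖)

    -- `trace-cong` reduces the claim to the machines before tracing, where completeness turns the
    -- circuit for `F` into `pure F`.
    feedback-⟦⟧ : ∀ {k m n} (s : V^ k) (F : Func (k + m) (k + n)) →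
                  ⟦ feedback s F ⟧ˢ ≈ˢ ! (feedbackᴹ s F)
    feedback-⟦⟧ {k} {m} {n} s F =
      trace-cong k ⟦ (regs s ⊗ idₘ m) ⨾ c ⟧ᴹ (cascade R (pure F)) λ σ i →
        trans (⟦⟧-⨾ (regs s ⊗ idₘ m) c σ i)
        (trans (‖‖-⟦⟧ F (fun ⟦ regs s ⊗ idₘ m ⟧ˢ σ) i)
        (trans (cong (Func.fun F) (body σ i)) (sym (!-cascade R (pure F) σ i))))
      where
      c : SCircTerm (k + m) (k + n)
      c = ConstForm.circuit ‖ F ‖
      R : Mealy (k + m) (k + m)
      R = direct (register s) (pure (idᶠ m))
      body : ⟦ regs s ⊗ idₘ m ⟧ˢ ≈ˢ ! R
      body σ i = trans (⟦⟧-⊗ (regs s) (idₘ m) σ i)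
        (trans (cong (_++ drop k (σ i))
                     (trans (regs-⟦⟧ s (take k ∘ σ) i) (sym (!-register s (take k ∘ σ) i))))
               (sym (!-direct (register s) (pure (idᶠ m)) σ i)))

    constant-⊥ : ∀ m n → Func m n
    constant-⊥ m n = record { fun = λ _ → ⊥ⱽ ; monotone = λ _ → ⊑ⱽ-refl ; ⊥-preserving = refl }

    trivial : (∀ v → v ≡ ●) → ∀ {n} (u v : V^ n) → u ≡ v
    trivial triv []      []      = refl
    trivial triv (x ∷ u) (y ∷ v) = cong₂ _∷_ (trans (triv x) (sym (triv y))) (trivial triv u v)

    -- The encoding of subsets needs a value other than `●`; finiteness of `V` allows a search for
    -- one.
    nontrivial? : (∃[ v ] v ≢ ●) ⊎ (∀ v → v ≡ ●)
    nontrivial? with Fin.any? (λ i → ¬? (Inverse.from (proj₂ V-finite) i ≟ ●))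
    ... | yes (i , p) = inj₁ (Inverse.from (proj₂ V-finite) i , p)
    ... | no  p       = inj₂ λ v → decidable-stable (v ≟ ●) λ v≢● →
      p (Inverse.to (proj₂ V-finite) v , v≢● ∘ trans (sym (Inverse.strictlyInverseʳ (proj₂ V-finite) v)))

    synthesise : ∀ {m n} (f : StreamMor m n) → ∃[ c ] ⟦ c ⟧ˢ ≈ˢ f
    synthesise {m} {n} f with nontrivial?
    -- With `●` as the only value all parallel stream functions agree, so any circuit `m` to `n`
    -- serves.
    ... | inj₂ triv = ConstForm.circuit ‖ constant-⊥ m n ‖ , λ σ i → trivial triv _ _
    ... | inj₁ (v , v≢●) = feedback (singleton initial) stepᶠ , λ σ i →
      trans (feedback-⟦⟧ (singleton initial) stepᶠ σ i) (correct (StreamMor.causal f) (StreamMor.monotone f) σ i)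
      where
      D = finiteDerivatives ∈-allⱽ (StreamMor.finitelySpecified f)
      open FiniteDerivatives D using (initial)
      open SubsetMachine v v≢● D

  -- The denotation as a morphism of PROPs, and the isomorphism.

  denotation : PROPMorphism SCirc/≈ StreamPROP
  denotation = record
    { map      = ⟦_⟧ˢ
    ; map-cong = id
    ; map-id   = λ _ _ _ → refl
    ; map-⨾    = ⟦⟧-⨾
    ; map-⊗    = ⟦⟧-⊗
    ; map-swap = λ _ _ _ _ → refl
    }

corollary4p100 : (Sg : Signature) (I : Interpretation Sg) → Semantics.IsComplete Sg I →
    Semantics.SCirc/≈ Sg I ≅ᴾ Semantics.StreamPROP Sg I
corollary4p100 Sg I complete =
  -- Faithfulness is `id`: equality in the quotient is by definition equality of denotations.
  faithful+split⇒≅ (denotation Sg I) id (proj₁ ∘ synthesise) (proj₂ ∘ synthesise)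
  where open Synthesis Sg I complete
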